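{- Let $\pi$ be a permutation of size $n$ with $k$ descents, let $\mathcal V(\pi)\subseteq\mathbb Z_{>0}^{k+1}$ be its set of valid compositions, and let $\mathrm{Fer}_\pi=\mathrm{conv}(\mathcal V(\pi))\subseteq\mathbb R^{k+1}$ be its fertilitope. Then \[\mathcal V(\pi)=\mathrm{Fer}_\pi\cap\mathbb Z^{k+1}.\]
   Context: A permutation of size $n\ge 1$ is an ordering $\pi=\pi_1\cdots\pi_n$ of a set of $n$ distinct positive integers. A descent of $\pi$ is an index $i\in[n-1]$ with $\pi_i>\pi_{i+1}$. The plot of $\pi$ is the set of points $(i,\pi_i)$, $i\in[n]$. A hook of $\pi$ with southwest endpoint $(i,\pi_i)$ and northeast endpoint $(j,\pi_j)$, where $i<j$ and $\pi_i<\pi_j$, is the union of the vertical segment from $(i,\pi_i)$ to $(i,\pi_j)$ and the horizontal segment from $(i,\pi_j)$ to $(j,\pi_j)$. A point $(m,\pi_m)$ lies directly above (respectively, below) this hook if $i<m<j$ and $\pi_m>\pi_j$ (respectively, $\pi_m<\pi_j$). Let $d_1<\cdots<d_k$ be the descents of $\pi$. A valid hook configuration of $\pi$ is a tuple $\mathcal H=(H_1,\ldots,H_k)$ of hooks of $\pi$ such that: (1) $H_i$ has southwest endpoint $(d_i,\pi_{d_i})$ for each $i$; (2) no point of the plot lies directly above a hook of $\mathcal H$; (3) no two hooks of $\mathcal H$ intersect or overlap, except that the northeast endpoint of one may be the southwest endpoint of another. (If $k=0$, there is exactly one, the empty configuration.) Let $\mathrm{VHC}(\pi)$ be the set of valid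 hook configurations of $\pi$. Each $\mathcal H\in\mathrm{VHC}(\pi)$ induces a coloring of the $n-k$ points of the plot that are not northeast endpoints of hooks of $\mathcal H$: such a point $(m,\pi_m)$ gets the color of the lowest hook of $\mathcal H$ lying above it (i.e. among the hooks of $\mathcal H$ below which it lies, the one whose northeast endpoint has smallest height; a hook is not considered to lie above its own southwest endpoint), and the color of the "sky" if there is no such hook. Let $q_i$ be the number of points with the color of $H_i$ ($1\le i\le k$) and $q_0$ the number with the color of the sky. Then $\mathbf q^{\mathcal H}=(q_0,\ldots,q_k)$ is a composition of $n-k$ into $k+1$ (positive) parts. Set $\mathcal V(\pi)=\{\mathbf q^{\mathcal H}:\mathcal H\in\mathrm{VHC}(\pi)\}$, the set of valid compositions of $\pi$; it may be empty. $\mathrm{conv}$ denotes convex hull. -}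

module Defs where

open import Data.Fin.Base as Fin using (Fin; zero; suc; toℕ)
open import Data.Fin.Properties as Fin using (all?; any?)
open import Data.Integer.Base using (ℤ; +_)
open import Data.List.Base as List using (List; filter; length; lookup)
open import Data.Nat.Base as ℕ using (ℕ; zero; suc; _⊔_)
import Data.Nat.Properties as ℕ
open import Data.Product.Base using (Σ; ∃; ∃-syntax; _×_; _,_)
open import Data.Rational.Base as ℚ using (ℚ; 0ℚ; 1ℚ; ½; ∣_∣)
import Data.Rational.Properties as ℚ
open import Data.Rational.Solver using (module +-*-Solver)
open import Data.Sum.Base using (_⊎_)
open import Data.Vec.Base as Vec using (count)
open import Data.Vec.Functional using (Vector; foldr)
open import Function.Base using (_∘_)
open import Function.Definitions using (Injective)
open import Level using (0ℓ)
open import Relation.Binary.PropositionalEquality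
open import Relation.Nullary using (¬_; Dec; ¬?; _×-dec_; _→-dec_)
open import Relation.Unary using (Pred; Decidable; _∈_; U)

------------------------------------------------------------------------
-- The real numbers: Cauchy sequences of rationals.  There is no quotient;
-- equality of reals is the relation _≈_ below.

record ℝ : Set where
  constructor mkℝ
  field
    seq    : ℕ → ℚ
    cauchy : ∀ ε → 0ℚ ℚ.< ε →
             ∃[ N ] ∀ m n → N ℕ.≤ m → N ℕ.≤ n → ∣ seq m ℚ.- seq n ∣ ℚ.< ε

open ℝ public

infix  4 _≈_ _≤_ _≈ᵥ_
infixl 6 _+_
infixl 7 _*_

_≈_ : ℝ → ℝ → Set
x ≈ y = ∀ ε → 0ℚ ℚ.< ε → ∃[ N ] ∀ n → N ℕ.≤ n → ∣ seq x n ℚ.- seq y n ∣ ℚ.< ε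

_≤_ : ℝ → ℝ → Set
x ≤ y = ∀ ε → 0ℚ ℚ.< ε → ∃[ N ] ∀ n → N ℕ.≤ n → seq x n ℚ.< seq y n ℚ.+ ε

fromℚ : ℚ → ℝ
fromℚ q = mkℝ (λ _ → q) λ ε 0<ε →
  0 , λ _ _ _ _ → subst (λ d → ∣ d ∣ ℚ.< ε) (sym (ℚ.+-inverseʳ q)) 0<ε

fromℤ : ℤ → ℝ
fromℤ z = fromℚ (z ℚ./ 1)

fromℕ : ℕ → ℝ
fromℕ n = fromℤ (+ n)

0ℝ 1ℝ : ℝ
0ℝ = fromℕ 0
1ℝ = fromℕ 1

_+_ : ℝ → ℝ → ℝ
x + y = mkℝ (λ n → seq x n ℚ.+ seq y n) λ ε 0<ε →
  let instance ε>0 = ℚ.positive 0<ε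
      h   = ½ ℚ.* ε
      0<h = ℚ.positive⁻¹ h {{ℚ.pos*pos⇒pos ½ ε}}
      (M , p) = cauchy x h 0<h
      (N , q) = cauchy y h 0<h
  in M ⊔ N , λ m n m≥ n≥ → begin-strict
    ∣ (seq x m ℚ.+ seq y m) ℚ.- (seq x n ℚ.+ seq y n) ∣
      ≡⟨ cong ∣_∣ (regroup (seq x m) (seq y m) (seq x n) (seq y n)) ⟩
    ∣ (seq x m ℚ.- seq x n) ℚ.+ (seq y m ℚ.- seq y n) ∣
      ≤⟨ ℚ.∣p+q∣≤∣p∣+∣q∣ (seq x m ℚ.- seq x n) (seq y m ℚ.- seq y n) ⟩
    ∣ seq x m ℚ.- seq x n ∣ ℚ.+ ∣ seq y m ℚ.- seq y n ∣
      <⟨ ℚ.+-mono-< (p m n (ℕ.m⊔n≤o⇒m≤o M N m≥) (ℕ.m⊔n≤o⇒m≤o M N n≥))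
                    (q m n (ℕ.m⊔n≤o⇒n≤o M N m≥) (ℕ.m⊔n≤o⇒n≤o M N n≥)) ⟩
    h ℚ.+ h
      ≡⟨ ℚ.*-distribʳ-+ ε ½ ½ ⟨
    1ℚ ℚ.* ε
      ≡⟨ ℚ.*-identityˡ ε ⟩
    ε ∎
  where
  open ℚ.≤-Reasoning
  regroup : ∀ a b c d → (a ℚ.+ b) ℚ.- (c ℚ.+ d) ≡ (a ℚ.- c) ℚ.+ (b ℚ.- d)
  regroup = solve 4 (λ a b c d → (a :+ b) :- (c :+ d) := (a :- c) :+ (b :- d)) refl
    where open +-*-Solver

eventuallyBounded : ∀ x → ∃[ B ] ℚ.Positive B × ∃[ N ] ∀ n → N ℕ.≤ n → ∣ seq x n ∣ ℚ.≤ B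
eventuallyBounded x =
  let (N , p) = cauchy x 1ℚ (ℚ.positive⁻¹ 1ℚ) in
  1ℚ ℚ.+ ∣ seq x N ∣ ,
  ℚ.pos+nonNeg⇒pos 1ℚ ∣ seq x N ∣ {{ℚ.∣-∣-nonNeg (seq x N)}} ,
  N , λ n n≥ → begin
    ∣ seq x n ∣
      ≡⟨ cong ∣_∣ (split (seq x n) (seq x N)) ⟩
    ∣ (seq x n ℚ.- seq x N) ℚ.+ seq x N ∣
      ≤⟨ ℚ.∣p+q∣≤∣p∣+∣q∣ (seq x n ℚ.- seq x N) (seq x N) ⟩
    ∣ seq x n ℚ.- seq x N ∣ ℚ.+ ∣ seq x N ∣
      ≤⟨ ℚ.+-monoˡ-≤ ∣ seq x N ∣ (ℚ.<⇒≤ (p n N n≥ ℕ.≤-refl)) ⟩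
    1ℚ ℚ.+ ∣ seq x N ∣ ∎
  where
  open ℚ.≤-Reasoning
  split : ∀ a b → a ≡ (a ℚ.- b) ℚ.+ b
  split = solve 2 (λ a b → a := (a :- b) :+ b) refl
    where open +-*-Solver

_*_ : ℝ → ℝ → ℝ
x * y = mkℝ (λ n → seq x n ℚ.* seq y n) λ ε 0<ε →
  let (A , A>0 , K , a) = eventuallyBounded x
      (B , B>0 , L , b) = eventuallyBounded y
      instance
        A⁺   = A>0
        B⁺   = B>0
        C>0  = ℚ.pos+pos⇒pos A B
        C≢0  = ℚ.pos⇒nonZero (A ℚ.+ B)
        ε>0  = ℚ.positive 0<ε
        C⁻¹  = ℚ.1/pos⇒pos (A ℚ.+ B)
      δ   = (ℚ.1/ (A ℚ.+ B)) ℚ.* ε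
      instance
        δ>0 = ℚ.pos*pos⇒pos (ℚ.1/ (A ℚ.+ B)) ε
      0<δ = ℚ.positive⁻¹ δ
      (M , p) = cauchy x δ 0<δ
      (N , q) = cauchy y δ 0<δ
  in (K ⊔ L) ⊔ (M ⊔ N) , λ m n m≥ n≥ →
    let KL≤m = ℕ.m⊔n≤o⇒m≤o (K ⊔ L) (M ⊔ N) m≥
        MN≤m = ℕ.m⊔n≤o⇒n≤o (K ⊔ L) (M ⊔ N) m≥
        KL≤n = ℕ.m⊔n≤o⇒m≤o (K ⊔ L) (M ⊔ N) n≥
        MN≤n = ℕ.m⊔n≤o⇒n≤o (K ⊔ L) (M ⊔ N) n≥
        dx = seq x m ℚ.- seq x n
        dy = seq y m ℚ.- seq y n
        instance
          dx≥0 = ℚ.∣-∣-nonNeg dx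
          dy≥0 = ℚ.∣-∣-nonNeg dy
    in begin-strict
    ∣ seq x m ℚ.* seq y m ℚ.- seq x n ℚ.* seq y n ∣
      ≡⟨ cong ∣_∣ (regroup (seq x m) (seq y m) (seq x n) (seq y n)) ⟩
    ∣ seq x m ℚ.* dy ℚ.+ seq y n ℚ.* dx ∣
      ≤⟨ ℚ.∣p+q∣≤∣p∣+∣q∣ (seq x m ℚ.* dy) (seq y n ℚ.* dx) ⟩
    ∣ seq x m ℚ.* dy ∣ ℚ.+ ∣ seq y n ℚ.* dx ∣
      ≡⟨ cong₂ ℚ._+_ (ℚ.∣p*q∣≡∣p∣*∣q∣ (seq x m) dy) (ℚ.∣p*q∣≡∣p∣*∣q∣ (seq y n) dx) ⟩
    ∣ seq x m ∣ ℚ.* ∣ dy ∣ ℚ.+ ∣ seq y n ∣ ℚ.* ∣ dx ∣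
      ≤⟨ ℚ.+-mono-≤
           (ℚ.*-monoʳ-≤-nonNeg ∣ dy ∣ (a m (ℕ.m⊔n≤o⇒m≤o K L KL≤m)))
           (ℚ.*-monoʳ-≤-nonNeg ∣ dx ∣ (b n (ℕ.m⊔n≤o⇒n≤o K L KL≤n))) ⟩
    A ℚ.* ∣ dy ∣ ℚ.+ B ℚ.* ∣ dx ∣
      <⟨ ℚ.+-mono-<
           (ℚ.*-monoʳ-<-pos A (q m n (ℕ.m⊔n≤o⇒n≤o M N MN≤m) (ℕ.m⊔n≤o⇒n≤o M N MN≤n)))
           (ℚ.*-monoʳ-<-pos B (p m n (ℕ.m⊔n≤o⇒m≤o M N MN≤m) (ℕ.m⊔n≤o⇒m≤o M N MN≤n))) ⟩
    A ℚ.* δ ℚ.+ B ℚ.* δ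
      ≡⟨ ℚ.*-distribʳ-+ δ A B ⟨
    (A ℚ.+ B) ℚ.* δ
      ≡⟨ ℚ.*-assoc (A ℚ.+ B) (ℚ.1/ (A ℚ.+ B)) ε ⟨
    ((A ℚ.+ B) ℚ.* (ℚ.1/ (A ℚ.+ B))) ℚ.* ε
      ≡⟨ cong (ℚ._* ε) (ℚ.*-inverseʳ (A ℚ.+ B)) ⟩
    1ℚ ℚ.* ε
      ≡⟨ ℚ.*-identityˡ ε ⟩
    ε ∎
  where
  open ℚ.≤-Reasoning
  regroup : ∀ a b c d → a ℚ.* b ℚ.- c ℚ.* d ≡ a ℚ.* (b ℚ.- d) ℚ.+ d ℚ.* (a ℚ.- c)
  regroup = solve 4 (λ a b c d → a :* b :- c :* d := a :* (b :- d) :+ d :* (a :- c)) refl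
    where open +-*-Solver

------------------------------------------------------------------------
-- Subsets of ℝᵈ

_≈ᵥ_ : ∀ {d} → Vector ℝ d → Vector ℝ d → Set
v ≈ᵥ w = ∀ c → v c ≈ w c

-- A set of integer vectors, regarded as a subset of ℝᵈ.
embed : ∀ {d} → Pred (Vector ℤ d) 0ℓ → Pred (Vector ℝ d) 0ℓ
embed S x = ∃[ z ] z ∈ S × x ≈ᵥ (fromℤ ∘ z)

ℤ^ : ∀ d → Pred (Vector ℝ d) 0ℓ
ℤ^ d = embed {d} U

∑ : ∀ {m} → Vector ℝ m → ℝ
∑ = foldr _+_ 0ℝ

conv : ∀ {d} → Pred (Vector ℝ d) 0ℓ → Pred (Vector ℝ d) 0ℓ
conv {d} S x =
  Σ ℕ λ m → Σ (Vector (Vector ℝ d) m) λ p → Σ (Vector ℝ m) λ w →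
    (∀ t → p t ∈ S) ×
    (∀ t → 0ℝ ≤ w t) ×
    ∑ w ≈ 1ℝ ×
    (x ≈ᵥ λ c → ∑ λ t → w t * p t c)

------------------------------------------------------------------------
-- Permutations

record Permutation (n : ℕ) : Set where
  field
    size≥1   : 1 ℕ.≤ n
    entry    : Fin n → ℕ
    positive : ∀ i → 1 ℕ.≤ entry i
    distinct : Injective _≡_ _≡_ entry

module _ {n : ℕ} (π : Permutation n) where

  open Permutation π

  IsDescent : Pred (Fin n) 0ℓ
  IsDescent i = ∃[ j ] toℕ j ≡ suc (toℕ i) × entry j ℕ.< entry i

  isDescent? : Decidable IsDescent
  isDescent? i = any? λ j → (toℕ j ℕ.≟ suc (toℕ i)) ×-dec (entry j ℕ.<? entry i)

  -- In increasing order, since allFin is.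
  descents : List (Fin n)
  descents = filter isDescent? (List.allFin n)

  des : ℕ
  des = length descents

  descent : Fin des → Fin n
  descent = lookup descents

  Point : Set
  Point = ℝ × ℝ

  _≈ₚ_ : Point → Point → Set
  (x , y) ≈ₚ (x′ , y′) = x ≈ x′ × y ≈ y′

  -- Positions are numbered from 1 in the plane, from 0 in Fin n.
  plot : Fin n → Point
  plot i = fromℕ (suc (toℕ i)) , fromℕ (entry i)

  record Hook : Set where
    field
      sw ne  : Fin n
      sw<ne  : sw Fin.< ne
      rising : entry sw ℕ.< entry ne

  open Hook public

  points : Hook → Pred Point 0ℓ
  points H (x , y) =
    let (x₀ , y₀) = plot (sw H) ; (x₁ , y₁) = plot (ne H) in
    (x ≈ x₀ × y₀ ≤ y × y ≤ y₁) ⊎ (y ≈ y₁ × x₀ ≤ x × x ≤ x₁)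

  DirectlyAbove DirectlyBelow : Fin n → Hook → Set
  DirectlyAbove m H = sw H Fin.< m × m Fin.< ne H × entry (ne H) ℕ.< entry m
  DirectlyBelow m H = sw H Fin.< m × m Fin.< ne H × entry m ℕ.< entry (ne H)

  record VHC : Set where
    field
      hook    : Fin des → Hook
      sw-hook : ∀ i → sw (hook i) ≡ descent i
      noAbove : ∀ i m → ¬ DirectlyAbove m (hook i)
      noMeet  : ∀ i j → i ≢ j → ∀ p → p ∈ points (hook i) → p ∈ points (hook j) →
                (p ≈ₚ plot (ne (hook i)) × p ≈ₚ plot (sw (hook j))) ⊎
                (p ≈ₚ plot (sw (hook i)) × p ≈ₚ plot (ne (hook j)))

  module _ (ℋ : VHC) where

    open VHC ℋ

    NotNE : Pred (Fin n) 0ℓ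
    NotNE m = ∀ i → m ≢ ne (hook i)

    -- Colour zero is the sky; colour suc i belongs to hook i.
    HasColour : Fin (suc des) → Pred (Fin n) 0ℓ
    HasColour zero    m = NotNE m × (∀ i → ¬ DirectlyBelow m (hook i))
    HasColour (suc i) m = NotNE m × DirectlyBelow m (hook i) ×
      (∀ j → DirectlyBelow m (hook j) → entry (ne (hook i)) ℕ.≤ entry (ne (hook j)))

    directlyBelow? : ∀ m H → Dec (DirectlyBelow m H)
    directlyBelow? m H =
      (sw H Fin.<? m) ×-dec (m Fin.<? ne H) ×-dec (entry m ℕ.<? entry (ne H))

    notNE? : Decidable NotNE
    notNE? m = all? λ i → ¬? (m Fin.≟ ne (hook i))

    hasColour? : ∀ c → Decidable (HasColour c)
    hasColour? zero    m = notNE? m ×-dec all? λ i → ¬? (directlyBelow? m (hook i))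
    hasColour? (suc i) m = notNE? m ×-dec directlyBelow? m (hook i) ×-dec
      all? λ j → directlyBelow? m (hook j) →-dec
                 (entry (ne (hook i)) ℕ.≤? entry (ne (hook j)))

    composition : Vector ℕ (suc des)
    composition c = count (hasColour? c) (Vec.allFin n)

  𝒱 : Pred (Vector ℤ (suc des)) _
  𝒱 z = Σ VHC λ ℋ → ∀ c → z c ≡ + composition ℋ c

  Fer : Pred (Vector ℝ (suc des)) _
  Fer = conv (embed 𝒱)

{-# OPTIONS --safe #-}

-- Let hook i occupy the interval (sw , ne] between its endpoints, and let the sky, treated as one
-- more hook, occupy (0 , n + 1].  Validity makes these intervals nested, and attributing each
-- position to the innermost interval around it assigns 1 + q_c positions to colour c.  For a vector
-- q consider the path
--     height q p = p - Σ { 1 + q_c | interval c starts before p }.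
-- For the composition of a configuration, height q p is minus the number of positions x > p owned by
-- an interval that starts before p; hence the path returns to its starting level at the end of every
-- interval and stays below that level inside it.  It follows that q is feasible: height q (n + 1) =
-- height q 0, and height q p < height q (start c) for all p > start c up to which no entry exceeds
-- that of descent c.  Conversely, if q is feasible, the first returns of the path to the levels of
-- the starts are the northeast endpoints of a valid hook configuration with composition q.
-- Feasibility consists of affine inequalities in q, so it passes to integer points of the convex
-- hull.
module Submission where

open import Defs hiding (_+_; _*_; _≤_; fromℕ)
import Defs as Real
open import Algebra.Bundles using (CommutativeRing)
open import Data.Empty using (⊥)
open import Data.Fin.Base as Fin using (Fin; zero; suc; toℕ; fromℕ; inject₁)
import Data.Fin.Induction as Fin
import Data.Fin.Properties as Fin
open import Data.Integer.Base as ℤ using (ℤ; +_; 0ℤ; 1ℤ; _+_; _-_; -_; _*_; +≤+; +<+)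
import Data.Integer.Properties as ℤ
open import Data.Integer.Solver using (module +-*-Solver)
import Data.List.Base as List
open import Data.List.Membership.Propositional.Properties using (∈-filter⁺; ∈-filter⁻; ∈-allFin; ∈-lookup)
import Data.List.Relation.Unary.All as All
open import Data.List.Relation.Unary.AllPairs using (AllPairs; _∷_)
import Data.List.Relation.Unary.AllPairs.Properties as AllPairs
import Data.List.Relation.Unary.Any.Properties as Any
open import Data.Nat.Base as ℕ using (ℕ; zero; suc)
import Data.Nat.Coprimality as Coprime
import Data.Nat.Properties as ℕ
open import Data.Product.Base using (∃; ∃-syntax; _×_; _,_; proj₁; proj₂; swap)
open import Data.Rational.Base as ℚ using (ℚ; 0ℚ; 1ℚ; ½; ∣_∣; mkℚ)
import Data.Rational.Properties as ℚ
open import Data.Rational.Solver renaming (module +-*-Solver to ℚ-Solver)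
open import Data.Sum.Base using (_⊎_; inj₁; inj₂; [_,_]′)
open import Data.Vec.Base as Vec using (count)
open import Data.Vec.Functional using (Vector)
open import Function.Base using (_∘_; id)
open import Induction.WellFounded using (Acc; acc)
open import Level using (0ℓ)
open import Relation.Binary.Definitions using (tri<; tri≈; tri>)
open import Relation.Binary.PropositionalEquality
open import Relation.Nullary using (¬_; Dec; yes; no; contradiction; _×-dec_)
open import Relation.Unary using (Pred; Decidable; _∈_; _∩_; _≐_)

import Algebra.Properties.Semiring.Sum ℤ.+-*-semiring as Σ
import Algebra.Properties.Semiring.Sum (CommutativeRing.semiring ℚ.+-*-commutativeRing) as ℚΣ
open ℚΣ using () renaming (sum to sumℚ)

-- Indicators and sums of integers

𝟙 : ∀ {P : Set} → Dec P → ℤ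
𝟙 (yes _) = 1ℤ
𝟙 (no _)  = 0ℤ

𝟙-true : ∀ {P : Set} (p? : Dec P) → P → 𝟙 p? ≡ 1ℤ
𝟙-true (yes _) p = refl
𝟙-true (no ¬p) p = contradiction p ¬p

𝟙-false : ∀ {P : Set} (p? : Dec P) → ¬ P → 𝟙 p? ≡ 0ℤ
𝟙-false (yes p) ¬p = contradiction p ¬p
𝟙-false (no _)  ¬p = refl

𝟙-mono : ∀ {P Q : Set} (p? : Dec P) (q? : Dec Q) → (P → Q) → 𝟙 p? ℤ.≤ 𝟙 q?
𝟙-mono (yes _) (yes _) f = ℤ.≤-refl
𝟙-mono (yes p) (no ¬q) f = contradiction (f p) ¬q
𝟙-mono (no _)  (yes _) f = +≤+ ℕ.z≤n
𝟙-mono (no _)  (no _)  f = ℤ.≤-refl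

𝟙-cong : ∀ {P Q : Set} (p? : Dec P) (q? : Dec Q) → (P → Q) → (Q → P) → 𝟙 p? ≡ 𝟙 q?
𝟙-cong p? (yes q) f g = 𝟙-true p? (g q)
𝟙-cong p? (no ¬q) f g = 𝟙-false p? (¬q ∘ f)

𝟙-⊎ : ∀ {P Q R : Set} (p? : Dec P) (q? : Dec Q) (r? : Dec R) →
      (P → Q ⊎ R) → (Q → P) → (R → P) → (Q → ¬ R) → 𝟙 p? ≡ 𝟙 q? + 𝟙 r?
𝟙-⊎ p? q? (yes r) f g h disjoint
  rewrite 𝟙-true p? (h r) | 𝟙-false q? (λ q → disjoint q r) = refl
𝟙-⊎ p? q? (no ¬r) f g h disjoint =
  trans (𝟙-cong p? q? (λ p → [ id , (λ r → contradiction r ¬r) ]′ (f p)) g) (sym (ℤ.+-identityʳ _))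

-- Kept abstract so that unification can read off the summand.
abstract

  sum : ∀ {n} → Vector ℤ n → ℤ
  sum = Σ.sum

  sum-empty : (f : Vector ℤ 0) → sum f ≡ 0ℤ
  sum-empty f = refl

  sum-suc : ∀ {n} (f : Vector ℤ (suc n)) → sum f ≡ f zero + sum (f ∘ suc)
  sum-suc f = refl

  sum-cong : ∀ {n} {f g : Vector ℤ n} → (∀ i → f i ≡ g i) → sum f ≡ sum g
  sum-cong = Σ.sum-cong-≗

  sum-+ : ∀ {n} (f g : Vector ℤ n) → sum (λ i → f i + g i) ≡ sum f + sum g
  sum-+ = Σ.∑-distrib-+

  sum-neg : ∀ {n} (f : Vector ℤ n) → sum (λ i → - f i) ≡ - sum f
  sum-neg {zero}  f = refl
  sum-neg {suc n} f =
    trans (cong (λ s → - f zero + s) (sum-neg (f ∘ suc))) (sym (ℤ.neg-distrib-+ (f zero) (sum (f ∘ suc))))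

  *-sum : ∀ {n} a (f : Vector ℤ n) → a * sum f ≡ sum (λ i → a * f i)
  *-sum = Σ.*-distribˡ-sum

  sum-comm : ∀ {m n} (f : Fin m → Fin n → ℤ) → sum (λ i → sum (f i)) ≡ sum (λ j → sum (λ i → f i j))
  sum-comm = Σ.∑-comm

  sum-init-last : ∀ {n} (f : Vector ℤ (suc n)) → sum f ≡ sum (f ∘ inject₁) + f (fromℕ n)
  sum-init-last = Σ.sum-init-last

  sum-zero : ∀ {n} {f : Vector ℤ n} → (∀ i → f i ≡ 0ℤ) → sum f ≡ 0ℤ
  sum-zero {n} f≡0 = trans (sum-cong f≡0) (Σ.sum-replicate-zero n)

  sum-single : ∀ {n} (f : Vector ℤ n) c → (∀ i → i ≢ c → f i ≡ 0ℤ) → sum f ≡ f c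
  sum-single {suc n} f zero f≡0 =
    trans (cong (λ s → f zero + s) (sum-zero {n} λ i → f≡0 (suc i) λ ())) (ℤ.+-identityʳ (f zero))
  sum-single f (suc c) f≡0 =
    trans (cong₂ _+_ (f≡0 zero λ ())
                     (sum-single (f ∘ suc) c λ i i≢c → f≡0 (suc i) (i≢c ∘ Fin.suc-injective)))
          (ℤ.+-identityˡ (f (suc c)))

  sum-mono-≤ : ∀ {n} {f g : Vector ℤ n} → (∀ i → f i ℤ.≤ g i) → sum f ℤ.≤ sum g
  sum-mono-≤ {zero}  f≤g = ℤ.≤-refl
  sum-mono-≤ {suc n} f≤g = ℤ.+-mono-≤ (f≤g zero) (sum-mono-≤ (f≤g ∘ suc))

  sum-mono-< : ∀ {n} {f g : Vector ℤ n} → (∀ i → f i ℤ.≤ g i) → ∀ i → f i ℤ.< g i → sum f ℤ.< sum g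
  sum-mono-< f≤g zero    f<g = ℤ.+-mono-<-≤ f<g (sum-mono-≤ (f≤g ∘ suc))
  sum-mono-< f≤g (suc i) f<g = ℤ.+-mono-≤-< (f≤g zero) (sum-mono-< (f≤g ∘ suc) i f<g)

  sum-𝟙-< : ∀ {n} p → p ℕ.≤ n → sum {n} (λ x → 𝟙 (toℕ x ℕ.<? p)) ≡ + p
  sum-𝟙-< {n} zero p≤n = sum-zero {n} λ x → 𝟙-false (toℕ x ℕ.<? 0) λ ()
  sum-𝟙-< {suc n} (suc p) (ℕ.s≤s p≤n) =
    cong (λ s → 1ℤ + s)
      (trans (sum-cong {n} λ x → 𝟙-cong (suc (toℕ x) ℕ.<? suc p) (toℕ x ℕ.<? p) ℕ.s<s⁻¹ ℕ.s<s)
             (sum-𝟙-< p p≤n))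

  count≡sum : ∀ {A : Set} {P : Pred A 0ℓ} (P? : Decidable P) {n} (f : Fin n → A) →
              + count P? (Vec.tabulate f) ≡ sum (λ i → 𝟙 (P? (f i)))
  count≡sum P? {zero}  f = refl
  count≡sum P? {suc n} f with P? (f zero)
  ... | yes _ = cong (λ s → 1ℤ + s) (count≡sum P? (f ∘ suc))
  ... | no  _ = trans (count≡sum P? (f ∘ suc)) (sym (ℤ.+-identityˡ _))

sum-- : ∀ {n} (f g : Vector ℤ n) → sum (λ i → f i - g i) ≡ sum f - sum g
sum-- f g = trans (sum-+ f (λ i → - g i)) (cong (λ s → sum f + s) (sum-neg g))

sum-𝟙-≟ : ∀ {n} (i : Fin n) → sum (λ j → 𝟙 (j Fin.≟ i)) ≡ 1ℤ
sum-𝟙-≟ i = trans (sum-single _ i λ j → 𝟙-false (j Fin.≟ i)) (𝟙-true (i Fin.≟ i) refl)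

greatest : ∀ {n} {P : Pred (Fin n) 0ℓ} → Decidable P → ∃ P → ∃[ c ] P c × ∀ i → P i → i Fin.≤ c
greatest {suc n} {P} P? (i , pi) with Fin.any? (P? ∘ suc)
... | yes h = let c , pc , max = greatest (P? ∘ suc) h in
  suc c , pc , λ { zero _ → ℕ.z≤n ; (suc j) pj → ℕ.s≤s (max j pj) }
greatest {suc n} {P} P? (zero , pi)  | no ¬h =
  zero , pi , λ { zero _ → ℕ.z≤n ; (suc j) pj → contradiction (j , pj) ¬h }
greatest {suc n} {P} P? (suc i , pi) | no ¬h = contradiction (i , pi) ¬h

least : ∀ {P : Pred ℕ 0ℓ} → Decidable P → ∀ {a b} → a ℕ.< b → P b →
        ∃[ p ] a ℕ.< p × p ℕ.≤ b × P p × ∀ r → a ℕ.< r → r ℕ.< p → ¬ P r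
least {P} P? {a} {b} a<b pb = go (b ℕ.∸ suc a) (suc a) (ℕ.n<1+n a) (ℕ.m∸n+n≡m a<b)
    λ r a<r r<1+a → contradiction a<r (ℕ.≤⇒≯ (ℕ.s≤s⁻¹ r<1+a))
  where
  go : ∀ k p → a ℕ.< p → k ℕ.+ p ≡ b → (∀ r → a ℕ.< r → r ℕ.< p → ¬ P r) →
       ∃[ p ] a ℕ.< p × p ℕ.≤ b × P p × ∀ r → a ℕ.< r → r ℕ.< p → ¬ P r
  go k p a<p k+p≡b none with P? p
  ... | yes pp = p , a<p , subst (p ℕ.≤_) k+p≡b (ℕ.m≤n+m p k) , pp , none
  go zero p a<p refl none    | no ¬pp = contradiction pb ¬pp
  go (suc k) p a<p k+p≡b none | no ¬pp =
    go k (suc p) (ℕ.m<n⇒m<1+n a<p) (trans (ℕ.+-suc k p) k+p≡b) none′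
    where
    none′ : ∀ r → a ℕ.< r → r ℕ.< suc p → ¬ P r
    none′ r a<r r<1+p with ℕ.m≤n⇒m<n∨m≡n (ℕ.s≤s⁻¹ r<1+p)
    ... | inj₁ r<p  = none r a<r r<p
    ... | inj₂ refl = ¬pp

-- Nested intervals and the height of a vector

module _ {k : ℕ} (s : Fin (suc k) → ℕ) where

  height : Vector ℤ (suc k) → ℕ → ℤ
  height z p = + p - sum λ c → 𝟙 (s c ℕ.<? p) * (1ℤ + z c)

  -- The coefficients depend only on which starts lie before `a` and before `p`. This form serves
  -- both the triangular system of `height-determines` and the passage to convex hulls.
  height-diff : ∀ z a p → height z a - height z p ≡
    (+ a - + p) + sum λ c → (𝟙 (s c ℕ.<? p) - 𝟙 (s c ℕ.<? a)) * (1ℤ + z c)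
  height-diff z a p = begin
    (+ a - sum (weighted a)) - (+ p - sum (weighted p))
      ≡⟨ solve 4 (λ a A p P → (a :- A) :- (p :- P) := (a :- p) :+ (P :- A)) refl
           (+ a) (sum (weighted a)) (+ p) (sum (weighted p)) ⟩
    (+ a - + p) + (sum (weighted p) - sum (weighted a))
      ≡⟨ cong (λ t → (+ a - + p) + t) (sum-- (weighted p) (weighted a)) ⟨
    (+ a - + p) + sum (λ c → weighted p c - weighted a c)
      ≡⟨ cong (λ t → (+ a - + p) + t) (sum-cong λ c →
           solve 3 (λ x y u → x :* u :- y :* u := (x :- y) :* u) refl
             (𝟙 (s c ℕ.<? p)) (𝟙 (s c ℕ.<? a)) (1ℤ + z c)) ⟩
    (+ a - + p) + sum (λ c → (𝟙 (s c ℕ.<? p) - 𝟙 (s c ℕ.<? a)) * (1ℤ + z c)) ∎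
    where
    open ≡-Reasoning
    open +-*-Solver
    weighted : ℕ → Fin (suc k) → ℤ
    weighted p c = 𝟙 (s c ℕ.<? p) * (1ℤ + z c)

  height-suc : ∀ z p → (∀ c → s c ≢ p) → height z (suc p) ≡ 1ℤ + height z p
  height-suc z p s≢p = begin
    + suc p - sum (λ c → 𝟙 (s c ℕ.<? suc p) * (1ℤ + z c))
      ≡⟨ cong (λ t → + suc p - t) (sum-cong λ c → cong (_* (1ℤ + z c))
           (𝟙-cong (s c ℕ.<? suc p) (s c ℕ.<? p)
             (λ sc<1+p → ℕ.≤∧≢⇒< (ℕ.s≤s⁻¹ sc<1+p) (s≢p c)) ℕ.m<n⇒m<1+n)) ⟩
    (1ℤ + + p) - sum (λ c → 𝟙 (s c ℕ.<? p) * (1ℤ + z c))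
      ≡⟨ ℤ.+-assoc 1ℤ (+ p) (- sum λ c → 𝟙 (s c ℕ.<? p) * (1ℤ + z c)) ⟩
    1ℤ + height z p ∎
    where open ≡-Reasoning

  -- The hypothesis of `e-inner` is strict because an interval may begin exactly where an earlier
  -- one ends, as hooks may touch there. Its strict conclusion makes the ends pairwise distinct.
  record Nested (n : ℕ) (e : Fin (suc k) → ℕ) : Set where
    field
      s-mono  : ∀ {i j} → i Fin.< j → s i ℕ.< s j
      s-zero  : s zero ≡ 0
      e-zero  : e zero ≡ suc n
      s<e     : ∀ c → s c ℕ.< e c
      e-inner : ∀ {i j} → i Fin.< j → s j ℕ.< e i → e j ℕ.< e i
      s≤n     : ∀ c → s c ℕ.≤ n

    s-mono-≤ : ∀ {i j} → i Fin.≤ j → s i ℕ.≤ s j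
    s-mono-≤ i≤j with ℕ.m≤n⇒m<n∨m≡n i≤j
    ... | inj₁ i<j = ℕ.<⇒≤ (s-mono i<j)
    ... | inj₂ i≡j rewrite Fin.toℕ-injective i≡j = ℕ.≤-refl

    e≤1+n : ∀ c → e c ℕ.≤ suc n
    e≤1+n zero    = ℕ.≤-reflexive e-zero
    e≤1+n (suc c) = ℕ.≤-trans (ℕ.<⇒≤ (e-inner {zero} (ℕ.s≤s ℕ.z≤n)
      (subst (s (suc c) ℕ.<_) (sym e-zero) (ℕ.s≤s (s≤n (suc c)))))) (ℕ.≤-reflexive e-zero)

    -- The index x stands for position x + 1, so that c covers the positions in (s c , e c].
    Covers : ℕ → Fin (suc k) → Set
    Covers x c = s c ℕ.≤ x × x ℕ.< e c

    covers? : ∀ x → Decidable (Covers x)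
    covers? x c = (s c ℕ.≤? x) ×-dec (x ℕ.<? e c)

    -- Starts increase with the index, so by nesting the greatest index covering a position belongs
    -- to the innermost interval. Interval `zero` covers every position, so the search cannot fail.
    innermost : (x : Fin (suc n)) → ∃[ c ] Covers (toℕ x) c × ∀ c′ → Covers (toℕ x) c′ → c′ Fin.≤ c
    innermost x = greatest (covers? (toℕ x)) (zero , ℕ.≤-trans (ℕ.≤-reflexive s-zero) ℕ.z≤n ,
      subst (toℕ x ℕ.<_) (sym e-zero) (Fin.toℕ<n x))

    owner : Fin (suc n) → Fin (suc k)
    owner = proj₁ ∘ innermost

    owner-covers : ∀ x → Covers (toℕ x) (owner x)
    owner-covers = proj₁ ∘ proj₂ ∘ innermost

    owner-greatest : ∀ x c → Covers (toℕ x) c → c Fin.≤ owner x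
    owner-greatest = proj₂ ∘ proj₂ ∘ innermost

    owner-unique : ∀ x c → Covers (toℕ x) c → (∀ c′ → Covers (toℕ x) c′ → c′ Fin.≤ c) → c ≡ owner x
    owner-unique x c cov max =
      Fin.≤-antisym (owner-greatest x c cov) (max (owner x) (owner-covers x))

    -- Since `x` stands for position `x + 1`, the second condition places that position strictly
    -- after `p`.
    Crosses : ℕ → Fin (suc n) → Set
    Crosses p x = s (owner x) ℕ.< p × p ℕ.≤ toℕ x

    crosses? : ∀ p → Decidable (Crosses p)
    crosses? p x = (s (owner x) ℕ.<? p) ×-dec (p ℕ.≤? toℕ x)

    -- Were position `x + 1` at or before `p`, it would lie in the interval of `c`, and its owner
    -- would start no earlier than `c`, against the crossing at `s c`.
    crosses-start⇒ : ∀ c {p} x → s c ℕ.< p → p ℕ.≤ e c → Crosses (s c) x → Crosses p x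
    crosses-start⇒ c {p} x s<p p≤e (so<s , s≤x) = ℕ.<-trans so<s s<p , p≤x
      where
      p≤x : p ℕ.≤ toℕ x
      p≤x with p ℕ.≤? toℕ x
      ... | yes p≤x = p≤x
      ... | no  p≰x = contradiction
        (s-mono-≤ (owner-greatest x c (s≤x , ℕ.<-≤-trans (ℕ.≰⇒> p≰x) p≤e))) (ℕ.<⇒≱ so<s)

    -- The owner reaches past `e c`, so it is neither `c` nor a later interval starting before
    -- `e c`, which would end before `e c` as well. Hence it precedes `c`.
    crosses-end⇒ : ∀ c x → Crosses (e c) x → Crosses (s c) x
    crosses-end⇒ c x (so<e , e≤x) = so<s , ℕ.≤-trans (ℕ.<⇒≤ (s<e c)) e≤x
      where
      x<eo = proj₂ (owner-covers x)
      so<s : s (owner x) ℕ.< s c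
      so<s with Fin.<-cmp (owner x) c
      ... | tri< o<c _ _ = s-mono o<c
      ... | tri≈ _ refl _ = contradiction x<eo (ℕ.≤⇒≯ e≤x)
      ... | tri> _ _ c<o = contradiction (ℕ.<-trans x<eo (e-inner c<o so<e)) (ℕ.≤⇒≯ e≤x)

    module _ (z : Vector ℤ (suc k)) (z-count : ∀ c → 1ℤ + z c ≡ sum λ x → 𝟙 (c Fin.≟ owner x)) where

      -- Exchanging the sums turns the weighted sum into the number of positions whose owner starts
      -- before `p`. These are the `p` positions up to `p`, all of which have such an owner,
      -- together with the crossings.
      height≡-crossings : ∀ {p} → p ℕ.≤ suc n → height z p ≡ - sum (λ x → 𝟙 (crosses? p x))
      height≡-crossings {p} p≤1+n = begin
        + p - sum (λ c → 𝟙 (s c ℕ.<? p) * (1ℤ + z c))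
          ≡⟨ cong (λ t → + p - t) (begin
            sum (λ c → 𝟙 (s c ℕ.<? p) * (1ℤ + z c))
              ≡⟨ sum-cong (λ c → trans (cong (λ t → 𝟙 (s c ℕ.<? p) * t) (z-count c)) (*-sum (𝟙 (s c ℕ.<? p)) _)) ⟩
            sum (λ c → sum λ x → 𝟙 (s c ℕ.<? p) * 𝟙 (c Fin.≟ owner x))
              ≡⟨ sum-comm _ ⟩
            sum (λ x → sum λ c → 𝟙 (s c ℕ.<? p) * 𝟙 (c Fin.≟ owner x))
              ≡⟨ sum-cong (λ x → trans
                   (sum-single _ (owner x) λ c c≢o →
                     trans (cong (λ t → 𝟙 (s c ℕ.<? p) * t) (𝟙-false (c Fin.≟ owner x) c≢o))
                           (ℤ.*-zeroʳ (𝟙 (s c ℕ.<? p))))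
                   (trans (cong (λ t → 𝟙 (s (owner x) ℕ.<? p) * t) (𝟙-true (owner x Fin.≟ owner x) refl))
                          (ℤ.*-identityʳ (𝟙 (s (owner x) ℕ.<? p))))) ⟩
            sum (λ x → 𝟙 (s (owner x) ℕ.<? p))
              ≡⟨ sum-cong (λ x → 𝟙-⊎ (s (owner x) ℕ.<? p) (toℕ x ℕ.<? p) (crosses? p x)
                   (split x) (ℕ.≤-<-trans (proj₁ (owner-covers x))) proj₁ (λ x<p (_ , p≤x) → ℕ.<⇒≱ x<p p≤x)) ⟩
            sum (λ x → 𝟙 (toℕ x ℕ.<? p) + 𝟙 (crosses? p x))
              ≡⟨ sum-+ _ _ ⟩
            sum {suc n} (λ x → 𝟙 (toℕ x ℕ.<? p)) + crossings
              ≡⟨ cong (_+ crossings) (sum-𝟙-< p p≤1+n) ⟩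
            + p + crossings ∎) ⟩
        + p - (+ p + crossings)
          ≡⟨ solve 2 (λ p c → p :- (p :+ c) := :- c) refl (+ p) crossings ⟩
        - crossings ∎
        where
        open ≡-Reasoning
        open +-*-Solver
        crossings = sum (λ x → 𝟙 (crosses? p x))
        split : ∀ x → s (owner x) ℕ.< p → toℕ x ℕ.< p ⊎ Crosses p x
        split x so<p with toℕ x ℕ.<? p
        ... | yes x<p = inj₁ x<p
        ... | no  x≮p = inj₂ (so<p , ℕ.≮⇒≥ x≮p)

      -- By the two lemmas on crossings, the same positions cross `s c` and `e c`.
      height-end : ∀ c → height z (e c) ≡ height z (s c)
      height-end c = begin
        height z (e c)
          ≡⟨ height≡-crossings (e≤1+n c) ⟩
        - sum (λ x → 𝟙 (crosses? (e c) x))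
          ≡⟨ cong -_ (sum-cong λ x → 𝟙-cong (crosses? (e c) x) (crosses? (s c) x)
               (crosses-end⇒ c x) (crosses-start⇒ c x (s<e c) ℕ.≤-refl)) ⟩
        - sum (λ x → 𝟙 (crosses? (s c) x))
          ≡⟨ height≡-crossings (ℕ.m≤n⇒m≤1+n (s≤n c)) ⟨
        height z (s c) ∎
        where open ≡-Reasoning

      -- The last position of the interval of c is an extra crossing at p.
      height-inside : ∀ c {p} → s c ℕ.< p → p ℕ.< e c → height z p ℤ.< height z (s c)
      height-inside c {p} s<p p<e = subst₂ ℤ._<_
        (sym (height≡-crossings (ℕ.<⇒≤ (ℕ.<-≤-trans p<e (e≤1+n c)))))
        (sym (height≡-crossings (ℕ.m≤n⇒m≤1+n (s≤n c))))
        (ℤ.neg-mono-< (sum-mono-<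
          (λ x → 𝟙-mono (crosses? (s c) x) (crosses? p x) (crosses-start⇒ c x s<p (ℕ.<⇒≤ p<e)))
          last
          (subst₂ ℤ._<_ (sym (𝟙-false (crosses? (s c) last) ¬crosses-start))
                        (sym (𝟙-true (crosses? p last) crosses-p)) (+<+ (ℕ.s≤s ℕ.z≤n)))))
        where
        1+pred = ℕ.suc-pred (e c) {{ℕ.>-nonZero (ℕ.≤-<-trans ℕ.z≤n p<e)}}
        pred<1+n : ℕ.pred (e c) ℕ.< suc n
        pred<1+n = subst (ℕ._≤ suc n) (sym 1+pred) (e≤1+n c)
        last : Fin (suc n)
        last = Fin.fromℕ< pred<1+n
        suc-last : suc (toℕ last) ≡ e c
        suc-last = trans (cong suc (Fin.toℕ-fromℕ< pred<1+n)) 1+pred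
        p≤last : p ℕ.≤ toℕ last
        p≤last = ℕ.s≤s⁻¹ (subst (p ℕ.<_) (sym suc-last) p<e)
        c-covers : Covers (toℕ last) c
        c-covers = ℕ.≤-trans (ℕ.<⇒≤ s<p) p≤last , ℕ.≤-reflexive suc-last
        ¬crosses-start : ¬ Crosses (s c) last
        ¬crosses-start (so<s , _) = ℕ.<⇒≱ so<s (s-mono-≤ (owner-greatest last c c-covers))
        -- An interval after `c` covering the last position of `c` would end no earlier than `e c`,
        -- against `e-inner`.
        owner≡c : c ≡ owner last
        owner≡c = owner-unique last c c-covers λ c′ (s≤l , l<e) → ℕ.≮⇒≥ λ c<c′ →
          contradiction (e-inner c<c′ (ℕ.≤-<-trans s≤l (ℕ.≤-reflexive suc-last)))
                        (ℕ.≤⇒≯ (subst (ℕ._≤ e c′) suc-last l<e))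
        crosses-p : Crosses p last
        crosses-p = subst (λ o → s o ℕ.< p) owner≡c s<p , p≤last

  module _ {e : Fin (suc k) → ℕ} (s-mono : ∀ {i j} → i Fin.< j → s i ℕ.< s j) (s<e : ∀ c → s c ℕ.< e c) where

    -- The system is triangular: the equation for c involves z only from c on, and z c with coefficient 1.
    height-determines : ∀ z z′ → (∀ c → height z (e c) ≡ height z (s c)) →
                        (∀ c → height z′ (e c) ≡ height z′ (s c)) → ∀ c → z c ≡ z′ c
    height-determines z z′ level level′ c = go c (Fin.>-wellFounded c)
      where
      open ≡-Reasoning
      coeff : Fin (suc k) → Fin (suc k) → ℤ
      coeff c i = 𝟙 (s i ℕ.<? s c) - 𝟙 (s i ℕ.<? e c)
      term : Vector ℤ (suc k) → Fin (suc k) → Fin (suc k) → ℤ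
      term z c i = coeff c i * (1ℤ + z i)
      total : ∀ z c → height z (e c) ≡ height z (s c) → sum (term z c) ≡ - (+ e c - + s c)
      total z c level = begin
        sum (term z c)
          ≡⟨ solve 2 (λ d t → t := :- d :+ (d :+ t)) refl (+ e c - + s c) (sum (term z c)) ⟩
        - (+ e c - + s c) + ((+ e c - + s c) + sum (term z c))
          ≡⟨ cong (λ t → - (+ e c - + s c) + t) (height-diff z (e c) (s c)) ⟨
        - (+ e c - + s c) + (height z (e c) - height z (s c))
          ≡⟨ cong (λ t → - (+ e c - + s c) + t) (ℤ.i≡j⇒i-j≡0 level) ⟩
        - (+ e c - + s c) + 0ℤ
          ≡⟨ ℤ.+-identityʳ _ ⟩
        - (+ e c - + s c) ∎
        where open +-*-Solver
      coeff-diag : ∀ c → coeff c c ≡ - 1ℤ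
      coeff-diag c = cong₂ _-_ (𝟙-false (s c ℕ.<? s c) (ℕ.<-irrefl refl)) (𝟙-true (s c ℕ.<? e c) (s<e c))
      coeff-before : ∀ c i → i Fin.< c → coeff c i ≡ 0ℤ
      coeff-before c i i<c = cong₂ _-_ (𝟙-true (s i ℕ.<? s c) (s-mono i<c))
        (𝟙-true (s i ℕ.<? e c) (ℕ.<-trans (s-mono i<c) (s<e c)))
      go : ∀ c → Acc Fin._>_ c → z c ≡ z′ c
      go c (acc rec) = begin
        z c
          ≡⟨ solve 1 (λ z → z := :- (con (- 1ℤ) :* (con 1ℤ :+ z)) :- con 1ℤ) refl (z c) ⟩
        - (- 1ℤ * (1ℤ + z c)) - 1ℤ
          ≡⟨ cong (λ t → - t - 1ℤ) (subst (λ t → t * (1ℤ + z c) ≡ t * (1ℤ + z′ c)) (coeff-diag c) diag) ⟩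
        - (- 1ℤ * (1ℤ + z′ c)) - 1ℤ
          ≡⟨ solve 1 (λ z → z := :- (con (- 1ℤ) :* (con 1ℤ :+ z)) :- con 1ℤ) refl (z′ c) ⟨
        z′ c ∎
        where
        open +-*-Solver
        off-diag : ∀ i → i ≢ c → term z c i - term z′ c i ≡ 0ℤ
        off-diag i i≢c with Fin.<-cmp i c
        ... | tri< i<c _ _ rewrite coeff-before c i i<c = refl
        ... | tri≈ _ i≡c _ = contradiction i≡c i≢c
        ... | tri> _ _ c<i rewrite go i (rec c<i) = ℤ.+-inverseʳ (term z′ c i)
        diag : term z c c ≡ term z′ c c
        diag = ℤ.i-j≡0⇒i≡j _ _ (begin
          term z c c - term z′ c c
            ≡⟨ sum-single (λ i → term z c i - term z′ c i) c off-diag ⟨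
          sum (λ i → term z c i - term z′ c i)
            ≡⟨ sum-- (term z c) (term z′ c) ⟩
          sum (term z c) - sum (term z′ c)
            ≡⟨ ℤ.i≡j⇒i-j≡0 (trans (total z c (level c)) (sym (total z′ c (level′ c)))) ⟩
          0ℤ ∎)

  -- Every start is matched with the first later position at which the height is regained.
  module _ (n : ℕ) (z : Vector ℤ (suc k)) (s≤n : ∀ c → s c ℕ.≤ n)
           (falls : ∀ c → height z (suc (s c)) ℤ.< height z (s c))
           (regained : ∀ c → height z (s c) ℤ.≤ height z (suc n)) where

    -- The path falls at a start and climbs by exactly one elsewhere, so it cannot jump over a level
    -- from below.
    height-suc-≤ : ∀ p → height z (suc p) ℤ.≤ 1ℤ + height z p
    height-suc-≤ p with Fin.any? (λ c → s c ℕ.≟ p)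
    ... | yes (c , refl) = ℤ.i≤j⇒i≤k+j 1ℤ (ℤ.<⇒≤ (falls c))
    ... | no  s≢p = ℤ.≤-reflexive (height-suc z p λ c sc≡p → s≢p (c , sc≡p))

    first-return : ∀ c → ∃[ p ] s c ℕ.< p × p ℕ.≤ suc n × height z (s c) ℤ.≤ height z p ×
                   ∀ r → s c ℕ.< r → r ℕ.< p → ¬ (height z (s c) ℤ.≤ height z r)
    first-return c = least (λ p → height z (s c) ℤ.≤? height z p) (ℕ.s≤s (s≤n c)) (regained c)

    return : Fin (suc k) → ℕ
    return = proj₁ ∘ first-return

    s<return : ∀ c → s c ℕ.< return c
    s<return = proj₁ ∘ proj₂ ∘ first-return

    return≤1+n : ∀ c → return c ℕ.≤ suc n
    return≤1+n = proj₁ ∘ proj₂ ∘ proj₂ ∘ first-return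

    height-before-return : ∀ c {r} → s c ℕ.< r → r ℕ.< return c → height z r ℤ.< height z (s c)
    height-before-return c s<r r<p = ℤ.≰⇒> (proj₂ (proj₂ (proj₂ (proj₂ (first-return c)))) _ s<r r<p)

    -- One step before the return the path is still strictly below the level of `c`, and a step
    -- climbs by at most one, so the level is met exactly.
    height-return : ∀ c → height z (return c) ≡ height z (s c)
    height-return c = ℤ.≤-antisym upper (proj₁ (proj₂ (proj₂ (proj₂ (first-return c)))))
      where
      below : ∀ p → s c ℕ.< suc p → suc p ≡ return c → height z (suc p) ℤ.≤ height z (s c)
      below p s<1+p 1+p≡return with ℕ.m≤n⇒m<n∨m≡n (ℕ.s≤s⁻¹ s<1+p)
      -- The position right after `s c` cannot be the return, but `falls` yields the bound wanted
      -- here at once.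
      ... | inj₂ refl = ℤ.<⇒≤ (falls c)
      ... | inj₁ s<p  = ℤ.≤-trans (height-suc-≤ p)
        (ℤ.i<j⇒suc[i]≤j (height-before-return c s<p (ℕ.≤-reflexive 1+p≡return)))
      upper : height z (return c) ℤ.≤ height z (s c)
      upper with return c | s<return c | below
      ... | suc p | s<p | below = below p s<p refl

    -- Before its return the path is below the level of `i`, so the level of `j` is lower than the
    -- height regained at `return i`. Up to `return j` the path does not exceed the level of `j`, so
    -- `return i` must come later.
    return-inner : (∀ {i j} → i Fin.< j → s i ℕ.< s j) →
                   ∀ {i j} → i Fin.< j → s j ℕ.< return i → return j ℕ.< return i
    return-inner s-mono {i} {j} i<j sj<return = ℕ.≰⇒> λ return≤return →
      [ (λ lt → ℤ.<⇒≱ higher (ℤ.<⇒≤ (height-before-return j sj<return lt)))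
      , (λ eq → ℤ.<-irrefl (trans (sym (height-return j)) (cong (height z) (sym eq))) higher)
      ]′ (ℕ.m≤n⇒m<n∨m≡n return≤return)
      where
      higher : height z (s j) ℤ.< height z (return i)
      higher = subst (height z (s j) ℤ.<_) (sym (height-return i)) (height-before-return i (s-mono i<j) sj<return)

-- Affine inequalities on convex hulls

ι : ℤ → ℚ
ι i = i ℚ./ 1

-- Division normalises its result and does not reduce on a variable; the literal fraction with
-- denominator one lets the arithmetic below compute.
ι-mkℚ : ∀ i → ι i ≡ mkℚ i 0 (Coprime.sym (Coprime.1-coprimeTo ℤ.∣ i ∣))
ι-mkℚ i = ℚ.↥p/↧p≡p (mkℚ i 0 (Coprime.sym (Coprime.1-coprimeTo ℤ.∣ i ∣)))

ι-+ : ∀ i j → ι (i + j) ≡ ι i ℚ.+ ι j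
ι-+ i j rewrite ι-mkℚ i | ι-mkℚ j = cong ι (sym (cong₂ _+_ (ℤ.*-identityʳ i) (ℤ.*-identityʳ j)))

ι-* : ∀ i j → ι (i * j) ≡ ι i ℚ.* ι j
ι-* i j rewrite ι-mkℚ i | ι-mkℚ j = refl

ι-mono-≤ : ∀ {i j} → i ℤ.≤ j → ι i ℚ.≤ ι j
ι-mono-≤ {i} {j} i≤j rewrite ι-mkℚ i | ι-mkℚ j = ℚ.*≤* (ℤ.*-monoʳ-≤-nonNeg 1ℤ i≤j)

ι-cancel-≤ : ∀ {i j} → ι i ℚ.≤ ι j → i ℤ.≤ j
ι-cancel-≤ {i} {j} i≤j rewrite ι-mkℚ i | ι-mkℚ j = ℤ.*-cancelʳ-≤-pos i j 1ℤ (ℚ.drop-*≤* i≤j)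

ι-sum : ∀ {n} (f : Vector ℤ n) → ι (sum f) ≡ sumℚ (ι ∘ f)
ι-sum {zero}  f = cong ι (sum-empty f)
ι-sum {suc n} f = begin
  ι (sum f)                          ≡⟨ cong ι (sum-suc f) ⟩
  ι (f zero + sum (f ∘ suc))         ≡⟨ ι-+ (f zero) (sum (f ∘ suc)) ⟩
  ι (f zero) ℚ.+ ι (sum (f ∘ suc))   ≡⟨ cong (λ s → ι (f zero) ℚ.+ s) (ι-sum (f ∘ suc)) ⟩
  sumℚ (ι ∘ f) ∎
  where open ≡-Reasoning

-- Null and asymptotically nonnegative sequences

Eventually : (ℕ → Set) → Set
Eventually P = ∃[ N ] ∀ n → N ℕ.≤ n → P n

eventually₂ : ∀ {P Q R : ℕ → Set} → (∀ n → P n → Q n → R n) → Eventually P → Eventually Q → Eventually R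
eventually₂ f (M , p) (N , q) =
  M ℕ.⊔ N , λ n n≥ → f n (p n (ℕ.m⊔n≤o⇒m≤o M N n≥)) (q n (ℕ.m⊔n≤o⇒n≤o M N n≥))

eventually₁ : ∀ {P Q : ℕ → Set} → (∀ n → P n → Q n) → Eventually P → Eventually Q
eventually₁ f (M , p) = M , λ n n≥ → f n (p n n≥)

always : ∀ {P : ℕ → Set} → (∀ n → P n) → Eventually P
always p = 0 , λ n _ → p n

Null : (ℕ → ℚ) → Set
Null s = ∀ ε → 0ℚ ℚ.< ε → Eventually λ n → ∣ s n ∣ ℚ.< ε

-- This is `0ℝ ≤ x` for a bare sequence. Being a record, it lets unification recover `s`.
record AlmostNonNeg (s : ℕ → ℚ) : Set where
  constructor almostNonNeg
  field above : ∀ ε → 0ℚ ℚ.< ε → Eventually λ n → 0ℚ ℚ.< s n ℚ.+ ε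

open AlmostNonNeg

half : ∀ {ε} → 0ℚ ℚ.< ε → 0ℚ ℚ.< ½ ℚ.* ε
half {ε} 0<ε = ℚ.positive⁻¹ (½ ℚ.* ε) {{ℚ.pos*pos⇒pos ½ ε {{ℚ.positive 0<ε}}}}

half+half : ∀ ε → ½ ℚ.* ε ℚ.+ ½ ℚ.* ε ≡ ε
half+half ε = trans (sym (ℚ.*-distribʳ-+ ε ½ ½)) (ℚ.*-identityˡ ε)

null-resp : ∀ {s t} → (∀ n → s n ≡ t n) → Null s → Null t
null-resp s≡t null ε 0<ε = eventually₁ (λ n → subst (λ q → ∣ q ∣ ℚ.< ε) (s≡t n)) (null ε 0<ε)

null-0 : Null λ _ → 0ℚ
null-0 ε 0<ε = always λ _ → 0<ε

null-neg : ∀ {s} → Null s → Null λ n → ℚ.- s n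
null-neg {s} null ε 0<ε = eventually₁ (λ n → subst (ℚ._< ε) (sym (ℚ.∣-p∣≡∣p∣ (s n)))) (null ε 0<ε)

null-+ : ∀ {s t} → Null s → Null t → Null λ n → s n ℚ.+ t n
null-+ {s} {t} s-null t-null ε 0<ε = eventually₂
  (λ n s< t< → subst (∣ s n ℚ.+ t n ∣ ℚ.<_) (half+half ε)
    (ℚ.≤-<-trans (ℚ.∣p+q∣≤∣p∣+∣q∣ (s n) (t n)) (ℚ.+-mono-< s< t<)))
  (s-null (½ ℚ.* ε) (half 0<ε)) (t-null (½ ℚ.* ε) (half 0<ε))

null-* : ∀ x {s} → Null s → Null λ n → seq x n ℚ.* s n
null-* x {s} null ε 0<ε =
  let (B , B>0 , bound) = eventuallyBounded x
      instance
        B⁺   = B>0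
        ε⁺   = ℚ.positive 0<ε
        B≢0  = ℚ.pos⇒nonZero B
        B⁻¹⁺ = ℚ.1/pos⇒pos B
      δ = ℚ.1/ B ℚ.* ε
  in eventually₂ (λ n x≤B s<δ → begin-strict
       ∣ seq x n ℚ.* s n ∣       ≡⟨ ℚ.∣p*q∣≡∣p∣*∣q∣ (seq x n) (s n) ⟩
       ∣ seq x n ∣ ℚ.* ∣ s n ∣   ≤⟨ ℚ.*-monoʳ-≤-nonNeg ∣ s n ∣ {{ℚ.∣-∣-nonNeg (s n)}} x≤B ⟩
       B ℚ.* ∣ s n ∣             <⟨ ℚ.*-monoʳ-<-pos B s<δ ⟩
       B ℚ.* (ℚ.1/ B ℚ.* ε)      ≡⟨ ℚ.*-assoc B (ℚ.1/ B) ε ⟨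
       B ℚ.* ℚ.1/ B ℚ.* ε        ≡⟨ cong (ℚ._* ε) (ℚ.*-inverseʳ B) ⟩
       1ℚ ℚ.* ε                  ≡⟨ ℚ.*-identityˡ ε ⟩
       ε                         ∎)
     bound (null δ (ℚ.positive⁻¹ δ {{ℚ.pos*pos⇒pos (ℚ.1/ B) ε}}))
  where open ℚ.≤-Reasoning

null-sum : ∀ {m} {s : Fin m → ℕ → ℚ} → (∀ i → Null (s i)) → Null λ n → sumℚ λ i → s i n
null-sum {zero}  null = null-0
null-sum {suc m} {s} null = null-+ (null zero) (null-sum {m} {s ∘ suc} (null ∘ suc))

almostNonNeg-resp : ∀ {s t} → (∀ n → s n ≡ t n) → AlmostNonNeg s → AlmostNonNeg t
almostNonNeg-resp s≡t s≥0 .above ε 0<ε =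
  eventually₁ (λ n → subst (λ q → 0ℚ ℚ.< q ℚ.+ ε) (s≡t n)) (above s≥0 ε 0<ε)

null⇒almostNonNeg : ∀ {s} → Null s → AlmostNonNeg s
null⇒almostNonNeg {s} null .above ε 0<ε = eventually₁ (λ n s<ε → begin-strict
    0ℚ                  ≡⟨ ℚ.+-inverseʳ (s n) ⟨
    s n ℚ.+ ℚ.- s n     ≤⟨ ℚ.+-monoʳ-≤ (s n) (p≤∣p∣ (ℚ.- s n)) ⟩
    s n ℚ.+ ∣ ℚ.- s n ∣ ≡⟨ cong (λ q → s n ℚ.+ q) (ℚ.∣-p∣≡∣p∣ (s n)) ⟩
    s n ℚ.+ ∣ s n ∣     <⟨ ℚ.+-monoʳ-< (s n) s<ε ⟩
    s n ℚ.+ ε           ∎) (null ε 0<ε)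
  where
  open ℚ.≤-Reasoning
  p≤∣p∣ : ∀ p → p ℚ.≤ ∣ p ∣
  p≤∣p∣ p with ℚ.≤-total 0ℚ p
  ... | inj₁ 0≤p = ℚ.≤-reflexive (sym (ℚ.0≤p⇒∣p∣≡p 0≤p))
  ... | inj₂ p≤0 = ℚ.≤-trans p≤0 (ℚ.0≤∣p∣ p)

almostNonNeg-+ : ∀ {s t} → AlmostNonNeg s → AlmostNonNeg t → AlmostNonNeg λ n → s n ℚ.+ t n
almostNonNeg-+ {s} {t} s≥0 t≥0 .above ε 0<ε = eventually₂
  (λ n s> t> → subst (0ℚ ℚ.<_) (regroup n) (ℚ.+-mono-< s> t>))
  (above s≥0 (½ ℚ.* ε) (half 0<ε)) (above t≥0 (½ ℚ.* ε) (half 0<ε))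
  where
  open ℚ-Solver
  regroup : ∀ n → (s n ℚ.+ ½ ℚ.* ε) ℚ.+ (t n ℚ.+ ½ ℚ.* ε) ≡ (s n ℚ.+ t n) ℚ.+ ε
  regroup n = trans
    (solve 3 (λ s t h → (s :+ h) :+ (t :+ h) := (s :+ t) :+ (h :+ h)) refl (s n) (t n) (½ ℚ.* ε))
    (cong (λ q → (s n ℚ.+ t n) ℚ.+ q) (half+half ε))

almostNonNeg-scale : ∀ {s} q → 0ℚ ℚ.≤ q → AlmostNonNeg s → AlmostNonNeg λ n → s n ℚ.* q
almostNonNeg-scale {s} q 0≤q s≥0 .above ε 0<ε with q ℚ.≟ 0ℚ
-- The tolerance `ε / q` of the other case does not exist here, but the scaled sequence is
-- constantly zero.
... | yes refl = always λ n → subst (0ℚ ℚ.<_)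
  (sym (trans (cong (ℚ._+ ε) (ℚ.*-zeroʳ (s n))) (ℚ.+-identityˡ ε))) 0<ε
... | no q≢0 =
  let instance
        q⁺   = ℚ.positive {q} (ℚ.≰⇒> λ q≤0 → q≢0 (ℚ.≤-antisym q≤0 0≤q))
        ε⁺   = ℚ.positive 0<ε
        q≢0′ = ℚ.pos⇒nonZero q
        q⁻¹⁺ = ℚ.1/pos⇒pos q
      δ = ε ℚ.* ℚ.1/ q
  in eventually₁ (λ n 0<s+δ → begin-strict
       0ℚ                         <⟨ ℚ.positive⁻¹ _ {{ℚ.pos*pos⇒pos (s n ℚ.+ δ) {{ℚ.positive 0<s+δ}} q}} ⟩
       (s n ℚ.+ δ) ℚ.* q          ≡⟨ ℚ.*-distribʳ-+ q (s n) δ ⟩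
       s n ℚ.* q ℚ.+ δ ℚ.* q      ≡⟨ cong (λ p → s n ℚ.* q ℚ.+ p) (ℚ.*-assoc ε (ℚ.1/ q) q) ⟩
       s n ℚ.* q ℚ.+ ε ℚ.* (ℚ.1/ q ℚ.* q)
                                  ≡⟨ cong (λ p → s n ℚ.* q ℚ.+ ε ℚ.* p) (ℚ.*-inverseˡ q) ⟩
       s n ℚ.* q ℚ.+ ε ℚ.* 1ℚ     ≡⟨ cong (λ p → s n ℚ.* q ℚ.+ p) (ℚ.*-identityʳ ε) ⟩
       s n ℚ.* q ℚ.+ ε            ∎)
     (above s≥0 δ (ℚ.positive⁻¹ δ {{ℚ.pos*pos⇒pos ε (ℚ.1/ q)}}))
  where open ℚ.≤-Reasoning

almostNonNeg-sum : ∀ {m} {s : Fin m → ℕ → ℚ} → (∀ i → AlmostNonNeg (s i)) →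
                   AlmostNonNeg λ n → sumℚ λ i → s i n
almostNonNeg-sum {zero}  s≥0 = null⇒almostNonNeg null-0
almostNonNeg-sum {suc m} {s} s≥0 = almostNonNeg-+ (s≥0 zero) (almostNonNeg-sum {m} {s ∘ suc} (s≥0 ∘ suc))

-- A negative `q` fails at the tolerance `- q`. This turns an asymptotic bound into an exact one.
almostNonNeg-const : ∀ {q} → AlmostNonNeg (λ _ → q) → 0ℚ ℚ.≤ q
almostNonNeg-const {q} q≥0 = ℚ.≮⇒≥ λ q<0 →
  let N , p = above q≥0 (ℚ.- q) (ℚ.neg-antimono-< q<0)
  in ℚ.<-irrefl (sym (ℚ.+-inverseʳ q)) (p N ℕ.≤-refl)

seq-∑ : ∀ {m} (w : Vector ℝ m) n → seq (∑ w) n ≡ sumℚ λ t → seq (w t) n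
seq-∑ {zero}  w n = refl
seq-∑ {suc m} w n = cong (λ q → seq (w zero) n ℚ.+ q) (seq-∑ (w ∘ suc) n)

module _ {d : ℕ} (b : ℤ) (a : Vector ℤ d) where

  affine : Vector ℤ d → ℤ
  affine z = b + sum λ c → a c * z c

  ι-affine : ∀ z → ι (affine z) ≡ ι b ℚ.+ sumℚ λ c → ι (a c) ℚ.* ι (z c)
  ι-affine z = trans (ι-+ b _) (cong (λ q → ι b ℚ.+ q)
    (trans (ι-sum _) (ℚΣ.sum-cong-≗ {d} λ c → ι-* (a c) (z c))))

  -- Rational approximations of the weights add up to one only in the limit. For arbitrary weights
  -- the value at `z` is exactly the weighted value plus one error for the missing mass and one for
  -- each coordinate.
  affine-defect : ∀ {m} (w : Vector ℚ m) (y : Vector (Vector ℤ d) m) z →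
    (ι b ℚ.* (1ℚ ℚ.- sumℚ w) ℚ.+ sumℚ λ c → ι (a c) ℚ.* (ι (z c) ℚ.- sumℚ λ t → w t ℚ.* ι (y t c)))
    ℚ.+ sumℚ (λ t → w t ℚ.* ι (affine (y t))) ≡ ι (affine z)
  affine-defect {m} w y z = begin
    (B ℚ.* (1ℚ ℚ.- W) ℚ.+ sumℚ λ c → A c ℚ.* (ι (z c) ℚ.- U c)) ℚ.+ sumℚ (λ t → w t ℚ.* ι (affine (y t)))
      ≡⟨ cong (λ q → (B ℚ.* (1ℚ ℚ.- W) ℚ.+ sumℚ λ c → A c ℚ.* (ι (z c) ℚ.- U c)) ℚ.+ q) weighted ⟩
    (B ℚ.* (1ℚ ℚ.- W) ℚ.+ sumℚ λ c → A c ℚ.* (ι (z c) ℚ.- U c)) ℚ.+ (W ℚ.* B ℚ.+ sumℚ λ c → A c ℚ.* U c)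
      ≡⟨ solve 4 (λ B W X Y → (B :* (con 1ℚ :- W) :+ X) :+ (W :* B :+ Y) := B :+ (X :+ Y)) refl
           B W (sumℚ λ c → A c ℚ.* (ι (z c) ℚ.- U c)) (sumℚ λ c → A c ℚ.* U c) ⟩
    B ℚ.+ (sumℚ (λ c → A c ℚ.* (ι (z c) ℚ.- U c)) ℚ.+ sumℚ (λ c → A c ℚ.* U c))
      ≡⟨ cong (λ q → B ℚ.+ q) (ℚΣ.∑-distrib-+ (λ c → A c ℚ.* (ι (z c) ℚ.- U c)) (λ c → A c ℚ.* U c)) ⟨
    B ℚ.+ sumℚ (λ c → A c ℚ.* (ι (z c) ℚ.- U c) ℚ.+ A c ℚ.* U c)
      ≡⟨ cong (λ q → B ℚ.+ q) (ℚΣ.sum-cong-≗ {d} λ c →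
           solve 3 (λ a z u → a :* (z :- u) :+ a :* u := a :* z) refl (A c) (ι (z c)) (U c)) ⟩
    B ℚ.+ sumℚ (λ c → A c ℚ.* ι (z c))
      ≡⟨ ι-affine z ⟨
    ι (affine z) ∎
    where
    open ≡-Reasoning
    open ℚ-Solver
    B = ι b
    W = sumℚ w
    A U : Fin d → ℚ
    A c = ι (a c)
    U c = sumℚ λ t → w t ℚ.* ι (y t c)
    weighted : sumℚ (λ t → w t ℚ.* ι (affine (y t))) ≡ W ℚ.* B ℚ.+ sumℚ λ c → A c ℚ.* U c
    weighted = begin
      sumℚ (λ t → w t ℚ.* ι (affine (y t)))
        ≡⟨ ℚΣ.sum-cong-≗ {m} (λ t → begin
          w t ℚ.* ι (affine (y t))
            ≡⟨ cong (λ q → w t ℚ.* q) (ι-affine (y t)) ⟩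
          w t ℚ.* (B ℚ.+ sumℚ λ c → A c ℚ.* ι (y t c))
            ≡⟨ ℚ.*-distribˡ-+ (w t) B _ ⟩
          w t ℚ.* B ℚ.+ w t ℚ.* sumℚ (λ c → A c ℚ.* ι (y t c))
            ≡⟨ cong (λ q → w t ℚ.* B ℚ.+ q) (ℚΣ.*-distribˡ-sum (w t) (λ c → A c ℚ.* ι (y t c))) ⟩
          w t ℚ.* B ℚ.+ sumℚ (λ c → w t ℚ.* (A c ℚ.* ι (y t c))) ∎) ⟩
      sumℚ (λ t → w t ℚ.* B ℚ.+ sumℚ λ c → w t ℚ.* (A c ℚ.* ι (y t c)))
        ≡⟨ ℚΣ.∑-distrib-+ (λ t → w t ℚ.* B) (λ t → sumℚ λ c → w t ℚ.* (A c ℚ.* ι (y t c))) ⟩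
      sumℚ (λ t → w t ℚ.* B) ℚ.+ sumℚ (λ t → sumℚ λ c → w t ℚ.* (A c ℚ.* ι (y t c)))
        ≡⟨ cong₂ ℚ._+_ (sym (ℚΣ.*-distribʳ-sum B w)) (ℚΣ.∑-comm λ t c → w t ℚ.* (A c ℚ.* ι (y t c))) ⟩
      W ℚ.* B ℚ.+ sumℚ (λ c → sumℚ λ t → w t ℚ.* (A c ℚ.* ι (y t c)))
        ≡⟨ cong (λ q → W ℚ.* B ℚ.+ q) (ℚΣ.sum-cong-≗ {d} λ c → begin
          sumℚ (λ t → w t ℚ.* (A c ℚ.* ι (y t c)))
            ≡⟨ ℚΣ.sum-cong-≗ {m} (λ t →
                 solve 3 (λ w a y → w :* (a :* y) := a :* (w :* y)) refl (w t) (A c) (ι (y t c))) ⟩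
          sumℚ (λ t → A c ℚ.* (w t ℚ.* ι (y t c)))
            ≡⟨ ℚΣ.*-distribˡ-sum (A c) (λ t → w t ℚ.* ι (y t c)) ⟨
          A c ℚ.* U c ∎) ⟩
      W ℚ.* B ℚ.+ sumℚ (λ c → A c ℚ.* U c) ∎

  -- The value at `z` is constant in `n`, yet at every `n` it is the error of `affine-defect`, which
  -- is null, plus nonnegative values weighted by asymptotically nonnegative weights.
  affine-nonneg : ∀ {S : Pred (Vector ℤ d) 0ℓ} {x z} → x ∈ conv (embed S) → x ≈ᵥ (fromℤ ∘ z) →
                  (∀ y → y ∈ S → 0ℤ ℤ.≤ affine y) → 0ℤ ℤ.≤ affine z
  affine-nonneg {S} {x} {z} (m , p , w , p∈S , w≥0 , ∑w≈1 , x≈∑wp) x≈z S≥0 =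
    ι-cancel-≤ (almostNonNeg-const (almostNonNeg-resp (λ n → affine-defect (λ t → seq (w t) n) y z)
      (almostNonNeg-+
        (null⇒almostNonNeg (null-+
          (null-* (fromℤ b) mass-null)
          (null-sum λ c → null-* (fromℤ (a c)) (coordinate-null c))))
        (almostNonNeg-sum λ t → almostNonNeg-scale {seq (w t)} (ι (affine (y t))) (ι-mono-≤ (S≥0 (y t) (y∈S t)))
           (almostNonNeg (w≥0 t))))))
    where
    y : Vector (Vector ℤ d) m
    y t = proj₁ (p∈S t)
    y∈S : ∀ t → y t ∈ S
    y∈S t = proj₁ (proj₂ (p∈S t))
    p≈y : ∀ t → p t ≈ᵥ (fromℤ ∘ y t)
    p≈y t = proj₂ (proj₂ (p∈S t))
    mass-null : Null λ n → 1ℚ ℚ.- sumℚ λ t → seq (w t) n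
    mass-null = null-resp
      (λ n → trans (solve 1 (λ W → :- (W :- con 1ℚ) := con 1ℚ :- W) refl (seq (∑ w) n))
                   (cong (λ q → 1ℚ ℚ.- q) (seq-∑ w n)))
      (null-neg ∑w≈1)
      where open ℚ-Solver
    -- Three approximations add up to this error: of `x` by `z`, of `x` by the convex combination,
    -- and of its points `p t` by the integer vectors `y t`.
    coordinate-null : ∀ c → Null λ n → ι (z c) ℚ.- sumℚ λ t → seq (w t) n ℚ.* ι (y t c)
    coordinate-null c = null-resp split
      (null-+ (null-+ (null-neg (x≈z c)) (x≈∑wp c)) (null-sum λ t → null-* (w t) (p≈y t c)))
      where
      open ≡-Reasoning
      open ℚ-Solver
      split : ∀ n → (ℚ.- (seq (x c) n ℚ.- ι (z c)) ℚ.+ (seq (x c) n ℚ.- seq (∑ λ t → w t Real.* p t c) n))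
                    ℚ.+ sumℚ (λ t → seq (w t) n ℚ.* (seq (p t c) n ℚ.- ι (y t c)))
                  ≡ ι (z c) ℚ.- sumℚ λ t → seq (w t) n ℚ.* ι (y t c)
      split n = begin
        (ℚ.- (X ℚ.- ι (z c)) ℚ.+ (X ℚ.- seq (∑ λ t → w t Real.* p t c) n)) ℚ.+ D
          ≡⟨ cong (λ q → (ℚ.- (X ℚ.- ι (z c)) ℚ.+ (X ℚ.- q)) ℚ.+ D)
               (trans (seq-∑ (λ t → w t Real.* p t c) n) (begin
                 sumℚ (λ t → seq (w t) n ℚ.* seq (p t c) n)
                   ≡⟨ ℚΣ.sum-cong-≗ {m} (λ t →
                        solve 3 (λ w p y → w :* p := w :* (p :- y) :+ w :* y) refl
                          (seq (w t) n) (seq (p t c) n) (ι (y t c))) ⟩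
                 sumℚ (λ t → seq (w t) n ℚ.* (seq (p t c) n ℚ.- ι (y t c)) ℚ.+ seq (w t) n ℚ.* ι (y t c))
                   ≡⟨ ℚΣ.∑-distrib-+ (λ t → seq (w t) n ℚ.* (seq (p t c) n ℚ.- ι (y t c)))
                                     (λ t → seq (w t) n ℚ.* ι (y t c)) ⟩
                 D ℚ.+ V ∎)) ⟩
        (ℚ.- (X ℚ.- ι (z c)) ℚ.+ (X ℚ.- (D ℚ.+ V))) ℚ.+ D
          ≡⟨ solve 4 (λ X Z D V → (:- (X :- Z) :+ (X :- (D :+ V))) :+ D := Z :- V) refl X (ι (z c)) D V ⟩
        ι (z c) ℚ.- V ∎
        where
        X = seq (x c) n
        D = sumℚ λ t → seq (w t) n ℚ.* (seq (p t c) n ℚ.- ι (y t c))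
        V = sumℚ λ t → seq (w t) n ℚ.* ι (y t c)

-- Order on the reals

≈-sym : ∀ {x y} → x ≈ y → y ≈ x
≈-sym {x} {y} x≈y = null-resp
  (λ n → solve 2 (λ x y → :- (x :- y) := y :- x) refl (seq x n) (seq y n)) (null-neg x≈y)
  where open ℚ-Solver

≈-refl : ∀ {x} → x ≈ x
≈-refl {x} = null-resp (λ n → sym (ℚ.+-inverseʳ (seq x n))) null-0

≈⇒≤ : ∀ {x y} → x ≈ y → x Real.≤ y
≈⇒≤ {x} {y} x≈y ε 0<ε = eventually₁
  (λ n 0<y-x+ε → subst₂ ℚ._<_ (ℚ.+-identityʳ (seq x n)) (cancel n ε) (ℚ.+-monoʳ-< (seq x n) 0<y-x+ε))
  (AlmostNonNeg.above (null⇒almostNonNeg (≈-sym {x} {y} x≈y)) ε 0<ε)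
  where
  open ℚ-Solver
  cancel : ∀ n ε → seq x n ℚ.+ ((seq y n ℚ.- seq x n) ℚ.+ ε) ≡ seq y n ℚ.+ ε
  cancel n = solve 3 (λ x y ε → x :+ ((y :- x) :+ ε) := y :+ ε) refl (seq x n) (seq y n)

≤-trans : ∀ {x y z} → x Real.≤ y → y Real.≤ z → x Real.≤ z
≤-trans {x} {y} {z} x≤y y≤z ε 0<ε = eventually₂
  (λ n x<y+ y<z+ → ℚ.<-≤-trans x<y+ (ℚ.≤-trans (ℚ.+-monoˡ-≤ _ (ℚ.<⇒≤ y<z+))
    (ℚ.≤-reflexive (trans (ℚ.+-assoc (seq z n) _ _) (cong (λ q → seq z n ℚ.+ q) (half+half ε))))))
  (x≤y _ (half 0<ε)) (y≤z _ (half 0<ε))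

fromℕ-mono-≤ : ∀ {a b} → a ℕ.≤ b → Real.fromℕ a Real.≤ Real.fromℕ b
fromℕ-mono-≤ {a} {b} a≤b ε 0<ε = always λ _ →
  ℚ.≤-<-trans (ι-mono-≤ (+≤+ a≤b))
    (subst (ℚ._< ι (+ b) ℚ.+ ε) (ℚ.+-identityʳ (ι (+ b))) (ℚ.+-monoʳ-< (ι (+ b)) 0<ε))

fromℕ-cancel-≤ : ∀ {a b} → Real.fromℕ a Real.≤ Real.fromℕ b → a ℕ.≤ b
fromℕ-cancel-≤ {a} {b} a≤b = ℤ.drop‿+≤+ (ι-cancel-≤ (ℚ.≮⇒≥ λ b<a →
  -- The gap itself serves as the tolerance, giving `a < b + (a - b)`.
  let gap = ι (+ a) ℚ.- ι (+ b)
      N , a< = a≤b gap (subst (ℚ._< gap) (ℚ.+-inverseʳ (ι (+ b))) (ℚ.+-monoˡ-< (ℚ.- ι (+ b)) b<a))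
  in ℚ.<-irrefl (cancel (ι (+ a)) (ι (+ b))) (a< N ℕ.≤-refl)))
  where
  open ℚ-Solver
  cancel : ∀ x y → x ≡ y ℚ.+ (x ℚ.- y)
  cancel = solve 2 (λ x y → x := y :+ (x :- y)) refl

fromℕ-injective : ∀ {a b} → Real.fromℕ a ≈ Real.fromℕ b → a ≡ b
fromℕ-injective {a} {b} a≈b = ℕ.≤-antisym
  (fromℕ-cancel-≤ (≈⇒≤ {Real.fromℕ a} {Real.fromℕ b} a≈b))
  (fromℕ-cancel-≤ (≈⇒≤ {Real.fromℕ b} {Real.fromℕ a} (≈-sym {Real.fromℕ a} {Real.fromℕ b} a≈b)))

-- Valid hook configurations

≢⇒<⊎> : ∀ {n} {i j : Fin n} → i ≢ j → i Fin.< j ⊎ j Fin.< i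
≢⇒<⊎> {i = i} {j} i≢j with Fin.<-cmp i j
... | tri< i<j _ _ = inj₁ i<j
... | tri≈ _ i≡j _ = contradiction i≡j i≢j
... | tri> _ _ j<i = inj₂ j<i

allPairs-lookup : ∀ {A : Set} {R : A → A → Set} {xs} → AllPairs R xs →
                  ∀ {i j} → i Fin.< j → R (List.lookup xs i) (List.lookup xs j)
allPairs-lookup (rx ∷ _)   {zero}  {suc j} _   = All.lookup rx (∈-lookup j)
allPairs-lookup (_ ∷ rxs) {suc i} {suc j} i<j = allPairs-lookup rxs (ℕ.s<s⁻¹ i<j)

module _ {n : ℕ} (π : Permutation n) where

  open Permutation π

  descent-mono : ∀ {i j} → i Fin.< j → descent π i Fin.< descent π j
  descent-mono = allPairs-lookup {R = Fin._<_} {xs = descents π}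
    (AllPairs.filter⁺ (isDescent? π) (AllPairs.tabulate⁺-< {f = id} id))

  descent-isDescent : ∀ i → IsDescent π (descent π i)
  descent-isDescent i = proj₂ (∈-filter⁻ (isDescent? π) {xs = List.allFin n} (∈-lookup i))

  descent-surjective : ∀ m → IsDescent π m → ∃[ i ] m ≡ descent π i
  descent-surjective m d = _ , Any.lookup-index (∈-filter⁺ (isDescent? π) (∈-allFin m) d)

  entry-≤∧≢⇒< : ∀ {l m} → entry l ℕ.≤ entry m → l ≢ m → entry l ℕ.< entry m
  entry-≤∧≢⇒< l≤m l≢m = ℕ.≤∧≢⇒< l≤m (l≢m ∘ distinct)

  -- Positions are numbered from 1; 0 and n + 1 delimit the interval of the sky.
  start : Fin (suc (des π)) → ℕ
  start zero    = 0
  start (suc i) = suc (toℕ (descent π i))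

  start-mono : ∀ {i j} → i Fin.< j → start i ℕ.< start j
  start-mono {zero}  {suc j} _   = ℕ.s≤s ℕ.z≤n
  start-mono {suc i} {suc j} i<j = ℕ.s≤s (descent-mono (ℕ.s<s⁻¹ i<j))

  start≤n : ∀ c → start c ℕ.≤ n
  start≤n zero    = ℕ.z≤n
  start≤n (suc i) = Fin.toℕ<n (descent π i)

  -- Index `m` is position `m + 1`, so the entry at `p` itself counts. The sky is never exceeded, so
  -- its condition in `Feasible` applies all the way to `n`.
  Exceeded : Fin (suc (des π)) → ℕ → Set
  Exceeded zero    p = ⊥
  Exceeded (suc i) p = ∃[ m ] descent π i Fin.< m × toℕ m ℕ.< p × entry (descent π i) ℕ.< entry m

  exceeded? : ∀ c p → Dec (Exceeded c p)
  exceeded? zero    p = no λ ()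
  exceeded? (suc i) p = Fin.any? λ m →
    (descent π i Fin.<? m) ×-dec (toℕ m ℕ.<? p) ×-dec (entry (descent π i) ℕ.<? entry m)

  -- Which inequalities are imposed depends on `π` alone, through `start` and `Exceeded`, so one
  -- fixed affine system serves all configurations at once.
  record Feasible (z : Vector ℤ (suc (des π))) : Set where
    field
      total : height start z (suc n) ≡ height start z 0
      below : ∀ c {p} → start c ℕ.< p → p ℕ.≤ n → ¬ Exceeded c p →
              height start z p ℤ.< height start z (start c)

  -- Feasibility of the composition of a configuration

  module _ (ℋ : VHC π) where

    open VHC ℋ

    end : Fin (suc (des π)) → ℕ
    end zero    = suc n
    end (suc i) = suc (toℕ (ne (hook i)))

    descent<ne : ∀ i → descent π i Fin.< ne (hook i)
    descent<ne i = subst (Fin._< ne (hook i)) (sw-hook i) (sw<ne (hook i))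

    entry≤ne : ∀ i {m} → descent π i Fin.< m → m Fin.≤ ne (hook i) → entry m ℕ.≤ entry (ne (hook i))
    entry≤ne i {m} d<m m≤ne with ℕ.m≤n⇒m<n∨m≡n m≤ne
    ... | inj₁ m<ne = ℕ.≮⇒≥ λ ne<m →
      noAbove i m (subst (Fin._< m) (sym (sw-hook i)) d<m , m<ne , ne<m)
    ... | inj₂ m≡ne = ℕ.≤-reflexive (cong entry (Fin.toℕ-injective m≡ne))

    -- If hook `j` extended at least to `ne (hook i)`, its northeast endpoint would be at least as
    -- high as that point, since no point lies above it. Its vertical segment would then meet the
    -- horizontal segment of hook `i` at `crossing`, strictly between the endpoints of hook `i`.
    ne-inner : ∀ {i j} → i Fin.< j → descent π j Fin.< ne (hook i) → ne (hook j) Fin.< ne (hook i)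
    ne-inner {i} {j} i<j dj<nei = ℕ.≰⇒> λ nei≤nej →
      [ (λ (p≈nei , _) → ℕ.<⇒≢ dj<nei (ℕ.suc-injective (fromℕ-injective (proj₁ p≈nei))))
      , (λ (p≈swi , _) → ℕ.<⇒≢ di<dj (sym (ℕ.suc-injective (trans (fromℕ-injective (proj₁ p≈swi))
                                          (cong (suc ∘ toℕ) (sw-hook i))))))
      ]′ (noMeet i j (Fin.<⇒≢ i<j) crossing
            (inj₂ (≈-refl {Real.fromℕ (entry (ne (hook i)))} ,
                   fromℕ-mono-≤ (ℕ.s≤s (subst (Fin._≤ descent π j) (sym (sw-hook i)) (ℕ.<⇒≤ di<dj))) ,
                   fromℕ-mono-≤ (ℕ.s≤s (ℕ.<⇒≤ dj<nei))))
            (inj₁ (subst (λ m → Real.fromℕ (suc (toℕ (descent π j))) ≈ Real.fromℕ (suc (toℕ m))) (sym (sw-hook j))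
                     (≈-refl {Real.fromℕ (suc (toℕ (descent π j)))}) ,
                   fromℕ-mono-≤ (subst (λ m → entry m ℕ.≤ entry (ne (hook i))) (sym (sw-hook j))
                     (entry≤ne i di<dj (ℕ.<⇒≤ dj<nei))) ,
                   fromℕ-mono-≤ (entry≤ne j dj<nei nei≤nej))))
      where
      di<dj = descent-mono i<j
      crossing : Point π
      crossing = Real.fromℕ (suc (toℕ (descent π j))) , Real.fromℕ (entry (ne (hook i)))

    nested : Nested start n end
    nested = record
      { s-mono  = start-mono
      ; s-zero  = refl
      ; e-zero  = refl
      ; s<e     = λ { zero → ℕ.s≤s ℕ.z≤n ; (suc i) → ℕ.s≤s (descent<ne i) }
      ; e-inner = end-inner
      ; s≤n     = start≤n
      }
      where
      end-inner : ∀ {i j} → i Fin.< j → start j ℕ.< end i → end j ℕ.< end i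
      end-inner {zero}  {suc j} _   _   = ℕ.s≤s (Fin.toℕ<n (ne (hook j)))
      end-inner {suc i} {suc j} i<j s<e = ℕ.s≤s (ne-inner (ℕ.s<s⁻¹ i<j) (ℕ.s<s⁻¹ s<e))

    open Nested nested using (Covers; owner; owner-covers; owner-greatest; owner-unique; e-inner)

    -- The interval of a hook contains its northeast endpoint, which is uncoloured. The sky ends at
    -- position `n + 1`, outside the plot, hence the empty first case.
    IsNE : Fin (suc (des π)) → Fin n → Set
    IsNE zero    m = ⊥
    IsNE (suc i) m = m ≡ ne (hook i)

    isNE? : ∀ c m → Dec (IsNE c m)
    isNE? zero    m = no λ ()
    isNE? (suc i) m = m Fin.≟ ne (hook i)

    Innermost : Fin (suc (des π)) → Fin n → Set
    Innermost c m = Covers (toℕ m) c × ∀ c′ → Covers (toℕ m) c′ → c′ Fin.≤ c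

    directlyBelow⇒covers : ∀ {m} i → DirectlyBelow π m (hook i) → Covers (toℕ m) (suc i)
    directlyBelow⇒covers {m} i (sw<m , m<ne , _) = subst (Fin._< m) (sw-hook i) sw<m , ℕ.m<n⇒m<1+n m<ne

    covers⇒directlyBelow : ∀ {m} i → m ≢ ne (hook i) → Covers (toℕ m) (suc i) → DirectlyBelow π m (hook i)
    covers⇒directlyBelow {m} i m≢ne (d<m , m<1+ne) =
      subst (Fin._< m) (sym (sw-hook i)) d<m , ℕ.≤∧≢⇒< m≤ne (m≢ne ∘ Fin.toℕ-injective) ,
      entry-≤∧≢⇒< (entry≤ne i d<m m≤ne) m≢ne
      where m≤ne = ℕ.s≤s⁻¹ m<1+ne

    isNE⇒innermost : ∀ c m → IsNE c m → Innermost c m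
    isNE⇒innermost (suc i) m refl = (descent<ne i , ℕ.≤-refl) , λ c′ (s≤m , m<e) → ℕ.≮⇒≥ λ i<c′ →
      ℕ.<⇒≱ (e-inner i<c′ (ℕ.s≤s s≤m)) m<e

    -- Of two hooks above a point, the one starting later ends further left by `ne-inner`, and hence
    -- lower, since no point lies above the outer hook. So the lowest hook is the innermost.
    hasColour⇒innermost : ∀ c m → HasColour π ℋ c m → Innermost c m
    hasColour⇒innermost zero m (notNE , notBelow) = (ℕ.z≤n , ℕ.m<n⇒m<1+n (Fin.toℕ<n m)) , λ where
      zero    _   → ℕ.z≤n
      (suc i) cov → contradiction (covers⇒directlyBelow i (notNE i) cov) (notBelow i)
    hasColour⇒innermost (suc i) m (notNE , below , lowest) = cov , λ where
        zero    _    → ℕ.z≤n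
        (suc j) cov′ → ℕ.≮⇒≥ λ i<j →
          let nej<nei = ne-inner (ℕ.s<s⁻¹ i<j) (ℕ.<-≤-trans (proj₁ cov′) (ℕ.s≤s⁻¹ (proj₂ cov)))
              di<nej  = ℕ.<-trans (descent-mono (ℕ.s<s⁻¹ i<j)) (descent<ne j)
          in ℕ.<⇒≱ (entry-≤∧≢⇒< (entry≤ne i di<nej (ℕ.<⇒≤ nej<nei)) (Fin.<⇒≢ nej<nei))
                   (lowest j (covers⇒directlyBelow j (notNE j) cov′))
      where cov = directlyBelow⇒covers i below

    innermost-unique : ∀ {c c′ m} → Innermost c m → Innermost c′ m → c ≡ c′
    innermost-unique (cov , max) (cov′ , max′) = Fin.≤-antisym (max′ _ cov) (max _ cov′)

    innermost⇒ : ∀ c m → Innermost c m → HasColour π ℋ c m ⊎ IsNE c m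
    innermost⇒ c m inner@(cov , max) with isNE? c m
    ... | yes isNE = inj₂ isNE
    ... | no ¬isNE = inj₁ (colour c cov max ¬isNE notNE)
      where
      notNE : NotNE π ℋ m
      notNE i m≡ne = ¬isNE (subst (λ c → IsNE c m)
        (innermost-unique {m = m} (isNE⇒innermost (suc i) m m≡ne) inner) m≡ne)
      colour : ∀ c → Covers (toℕ m) c → (∀ c′ → Covers (toℕ m) c′ → c′ Fin.≤ c) →
               ¬ IsNE c m → NotNE π ℋ m → HasColour π ℋ c m
      colour zero cov max _ notNE = notNE , λ i below →
        contradiction (max (suc i) (directlyBelow⇒covers i below)) λ ()
      colour (suc i) cov max m≢ne notNE = notNE , covers⇒directlyBelow i m≢ne cov , λ j below →
        let cov′ = directlyBelow⇒covers j below in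
        [ (λ j<i → entry≤ne j (ℕ.<-trans (descent-mono j<i) (descent<ne i))
                     (ℕ.<⇒≤ (ne-inner j<i (ℕ.<-≤-trans (proj₁ cov) (ℕ.s≤s⁻¹ (proj₂ cov′))))))
        , (λ j≡i → ℕ.≤-reflexive (cong (λ i → entry (ne (hook i))) (sym (Fin.toℕ-injective j≡i))))
        ]′ (ℕ.m≤n⇒m<n∨m≡n (ℕ.s≤s⁻¹ (max (suc j) cov′)))

    hasColour⇒¬isNE : ∀ c m → HasColour π ℋ c m → ¬ IsNE c m
    hasColour⇒¬isNE (suc i) m (notNE , _) = notNE i

    owned-points : ∀ c m → 𝟙 (c Fin.≟ owner (inject₁ m)) ≡ 𝟙 (hasColour? π ℋ c m) + 𝟙 (isNE? c m)
    owned-points c m = 𝟙-⊎ (c Fin.≟ owner (inject₁ m)) (hasColour? π ℋ c m) (isNE? c m)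
      (λ c≡o → innermost⇒ c m (subst (λ c → Innermost c m) (sym c≡o)
        (subst (λ x → Covers x (owner (inject₁ m))) x≡m (owner-covers (inject₁ m)) ,
         λ c′ cov → owner-greatest (inject₁ m) c′ (subst (λ x → Covers x c′) (sym x≡m) cov))))
      (innermost⇒≡ ∘ hasColour⇒innermost c m)
      (innermost⇒≡ ∘ isNE⇒innermost c m)
      (hasColour⇒¬isNE c m)
      where
      x≡m = Fin.toℕ-inject₁ m
      innermost⇒≡ : Innermost c m → c ≡ owner (inject₁ m)
      innermost⇒≡ (cov , max) = owner-unique (inject₁ m) c (subst (λ x → Covers x c) (sym x≡m) cov)
        λ c′ cov′ → max c′ (subst (λ x → Covers x c′) x≡m cov′)

    owner-last : zero ≡ owner (fromℕ n)
    owner-last = owner-unique (fromℕ n) zero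
      (ℕ.z≤n , ℕ.s≤s (ℕ.≤-reflexive (Fin.toℕ-fromℕ n))) λ where
        zero    _        → ℕ.z≤n
        (suc i) (_ , lt) → contradiction
          (ℕ.≤-<-trans (ℕ.≤-reflexive (sym (Fin.toℕ-fromℕ n)))
             (ℕ.≤-<-trans (ℕ.s≤s⁻¹ lt) (Fin.toℕ<n (ne (hook i))))) (ℕ.<-irrefl refl)

    sizes : Vector ℤ (suc (des π))
    sizes c = + composition π ℋ c

    -- The summand 1ℤ stands for the end of the interval: the northeast endpoint of a hook, or
    -- position n + 1 for the sky.
    sizes-count : ∀ c → 1ℤ + sizes c ≡ sum λ x → 𝟙 (c Fin.≟ owner x)
    sizes-count c = begin
      1ℤ + sizes c
        ≡⟨ cong₂ _+_ (sym (ends c)) (count≡sum (hasColour? π ℋ c) id) ⟩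
      (sum (λ m → 𝟙 (isNE? c m)) + 𝟙 (c Fin.≟ owner (fromℕ n))) + sum (λ m → 𝟙 (hasColour? π ℋ c m))
        ≡⟨ solve 3 (λ x y z → (x :+ y) :+ z := (z :+ x) :+ y) refl
             (sum λ m → 𝟙 (isNE? c m)) (𝟙 (c Fin.≟ owner (fromℕ n))) (sum λ m → 𝟙 (hasColour? π ℋ c m)) ⟩
      (sum (λ m → 𝟙 (hasColour? π ℋ c m)) + sum (λ m → 𝟙 (isNE? c m))) + 𝟙 (c Fin.≟ owner (fromℕ n))
        ≡⟨ cong (_+ 𝟙 (c Fin.≟ owner (fromℕ n))) (begin
          sum (λ m → 𝟙 (hasColour? π ℋ c m)) + sum (λ m → 𝟙 (isNE? c m))
            ≡⟨ sum-+ _ _ ⟨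
          sum (λ m → 𝟙 (hasColour? π ℋ c m) + 𝟙 (isNE? c m))
            ≡⟨ sum-cong (owned-points c) ⟨
          sum (λ m → 𝟙 (c Fin.≟ owner (inject₁ m))) ∎) ⟩
      sum (λ m → 𝟙 (c Fin.≟ owner (inject₁ m))) + 𝟙 (c Fin.≟ owner (fromℕ n))
        ≡⟨ sum-init-last (λ x → 𝟙 (c Fin.≟ owner x)) ⟨
      sum (λ x → 𝟙 (c Fin.≟ owner x)) ∎
      where
      open ≡-Reasoning
      open +-*-Solver
      ends : ∀ c → sum (λ m → 𝟙 (isNE? c m)) + 𝟙 (c Fin.≟ owner (fromℕ n)) ≡ 1ℤ
      ends zero    = cong₂ _+_ (sum-zero λ _ → refl) (𝟙-true (zero Fin.≟ owner (fromℕ n)) owner-last)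
      ends (suc i) = cong₂ _+_ (sum-𝟙-≟ (ne (hook i)))
        (𝟙-false (suc i Fin.≟ owner (fromℕ n)) λ si≡o → Fin.0≢1+n (trans owner-last (sym si≡o)))

    sizes-height-end : ∀ c → height start sizes (end c) ≡ height start sizes (start c)
    sizes-height-end = Nested.height-end nested sizes sizes-count

    sizes-feasible : Feasible sizes
    sizes-feasible = record
      { total = sizes-height-end zero
      ; below = λ c s<p p≤n ¬exceeded →
          Nested.height-inside nested sizes sizes-count c s<p (p<end c s<p p≤n ¬exceeded)
      }
      where
      -- By `rising` the northeast endpoint itself exceeds the entry of the descent, so it lies
      -- after `p` if nothing up to `p` does.
      p<end : ∀ c {p} → start c ℕ.< p → p ℕ.≤ n → ¬ Exceeded c p → p ℕ.< end c
      p<end zero    _ p≤n _ = ℕ.s≤s p≤n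
      p<end (suc i) _ _ ¬exceeded = ℕ.s≤s (ℕ.≮⇒≥ λ ne<p → ¬exceeded
        (ne (hook i) , descent<ne i , ne<p ,
         subst (λ m → entry m ℕ.< entry (ne (hook i))) (sw-hook i) (rising (hook i))))

  -- The configuration of a feasible vector

  module _ {z : Vector ℤ (suc (des π))} (feasible : Feasible z) where

    open Feasible feasible

    -- The only entry to check is the one right after the descent, and it is smaller.
    ¬exceeded-suc : ∀ c → ¬ Exceeded c (suc (start c))
    ¬exceeded-suc (suc i) (m , d<m , m<2+d , d<m′) with j , j≡1+d , j<d ← descent-isDescent i =
      ℕ.<-asym j<d (subst (λ m → entry (descent π i) ℕ.< entry m) m≡j d<m′)
      where
      m≡j : m ≡ j
      m≡j = Fin.toℕ-injective (trans (ℕ.≤-antisym (ℕ.s≤s⁻¹ m<2+d) d<m) (sym j≡1+d))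

    start<n : ∀ c → start c ℕ.< n
    start<n zero    = size≥1
    start<n (suc i) with j , j≡1+d , _ ← descent-isDescent i = subst (ℕ._< n) j≡1+d (Fin.toℕ<n j)

    falls : ∀ c → height start z (suc (start c)) ℤ.< height start z (start c)
    falls c = below c ℕ.≤-refl (start<n c) (¬exceeded-suc c)

    -- The condition for the sky keeps the path below its initial level at positions `1` to `n`, and
    -- `total` restores that level at `n + 1`.
    regained : ∀ c → height start z (start c) ℤ.≤ height start z (suc n)
    regained zero    = ℤ.≤-reflexive (sym total)
    regained (suc i) = ℤ.≤-trans (ℤ.<⇒≤ (below zero (ℕ.s≤s ℕ.z≤n) (start≤n (suc i)) λ ()))
                                 (ℤ.≤-reflexive (sym total))

    abstract

      target : Fin (suc (des π)) → ℕ
      target = return start n z start≤n falls regained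

      start<target : ∀ c → start c ℕ.< target c
      start<target = s<return start n z start≤n falls regained

      height-target : ∀ c → height start z (target c) ≡ height start z (start c)
      height-target = height-return start n z start≤n falls regained

      target-inner : ∀ {i j} → i Fin.< j → start j ℕ.< target i → target j ℕ.< target i
      target-inner = return-inner start n z start≤n falls regained start-mono

      target≤1+n : ∀ c → target c ℕ.≤ suc n
      target≤1+n = return≤1+n start n z start≤n falls regained

    -- Otherwise `below` would hold the path strictly under its starting level exactly where it has
    -- returned. For the sky this forces the target past `n`.
    target-exceeded : ∀ c → target c ℕ.≤ n → Exceeded c (target c)
    target-exceeded c t≤n with exceeded? c (target c)
    ... | yes exceeded = exceeded
    ... | no ¬exceeded = contradiction (below c (start<target c) t≤n ¬exceeded)
                                     (ℤ.<-irrefl (height-target c))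

    target-sky : target zero ≡ suc n
    target-sky = ℕ.≤-antisym (target≤1+n zero)
      (ℕ.≰⇒> (target-exceeded zero))

    target≤n : ∀ i → target (suc i) ℕ.≤ n
    target≤n i = ℕ.s≤s⁻¹ (subst (target (suc i) ℕ.<_) target-sky
      (target-inner {zero} {suc i} (ℕ.s≤s ℕ.z≤n)
        (subst (start (suc i) ℕ.<_) (sym target-sky) (ℕ.s≤s (start≤n (suc i))))))

    suc-pred-target : ∀ i → suc (ℕ.pred (target (suc i))) ≡ target (suc i)
    suc-pred-target i = ℕ.suc-pred (target (suc i)) {{ℕ.>-nonZero (ℕ.≤-<-trans ℕ.z≤n (start<target (suc i)))}}

    pred-target<n : ∀ i → ℕ.pred (target (suc i)) ℕ.< n
    pred-target<n i = subst (ℕ._≤ n) (sym (suc-pred-target i)) (target≤n i)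

    abstract

      northeast : Fin (des π) → Fin n
      northeast i = Fin.fromℕ< (pred-target<n i)

      suc-northeast : ∀ i → suc (toℕ (northeast i)) ≡ target (suc i)
      suc-northeast i = trans (cong suc (Fin.toℕ-fromℕ< (pred-target<n i))) (suc-pred-target i)

    descent<northeast : ∀ i → descent π i Fin.< northeast i
    descent<northeast i = ℕ.s<s⁻¹ (subst (start (suc i) ℕ.<_) (sym (suc-northeast i)) (start<target (suc i)))

    northeast-inner : ∀ {i j} → i Fin.< j → descent π j Fin.< northeast i → northeast j Fin.< northeast i
    northeast-inner {i} {j} i<j d<ne = ℕ.s<s⁻¹ (subst₂ ℕ._<_ (sym (suc-northeast j)) (sym (suc-northeast i))
      (target-inner (ℕ.s<s i<j) (subst (start (suc j) ℕ.<_) (suc-northeast i) (ℕ.s<s d<ne))))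

    descent-exceeded : ∀ i → ∃[ m ] descent π i Fin.< m × m Fin.≤ northeast i × entry (descent π i) ℕ.< entry m
    descent-exceeded i = let m , d<m , m<t , lower = target-exceeded (suc i) (target≤n i) in
      m , d<m , ℕ.s≤s⁻¹ (subst (toℕ m ℕ.<_) (sym (suc-northeast i)) m<t) , lower

    -- At an ascent the next entry is higher. At a descent `j` some entry up to `northeast j` is
    -- higher, and nesting puts `northeast j` no later than `northeast i`.
    ascend : ∀ i m → descent π i Fin.≤ m → m Fin.< northeast i →
             ∃[ m′ ] m Fin.< m′ × m′ Fin.≤ northeast i × entry m ℕ.< entry m′
    ascend i m d≤m m<ne = step (isDescent? π m)
      where
      1+m<n = ℕ.≤-<-trans m<ne (Fin.toℕ<n (northeast i))
      m⁺ = Fin.fromℕ< 1+m<n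
      m⁺≡1+m : toℕ m⁺ ≡ suc (toℕ m)
      m⁺≡1+m = Fin.toℕ-fromℕ< 1+m<n
      m<m⁺ : m Fin.< m⁺
      m<m⁺ = ℕ.≤-reflexive (sym m⁺≡1+m)

      from-descent : ∀ j → descent π i Fin.≤ descent π j → descent π j Fin.< northeast i →
                     ∃[ m′ ] descent π j Fin.< m′ × m′ Fin.≤ northeast i × entry (descent π j) ℕ.< entry m′
      from-descent j d≤dj dj<ne with Fin.<-cmp i j
      ... | tri≈ _ refl _ = descent-exceeded i
      ... | tri> _ _ j<i  = contradiction d≤dj (ℕ.<⇒≱ (descent-mono j<i))
      ... | tri< i<j _ _  = let m′ , dj<m′ , m′≤ne , lower = descent-exceeded j in
        m′ , dj<m′ , ℕ.≤-trans m′≤ne (ℕ.<⇒≤ (northeast-inner i<j dj<ne)) , lower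

      step : Dec (IsDescent π m) → ∃[ m′ ] m Fin.< m′ × m′ Fin.≤ northeast i × entry m ℕ.< entry m′
      step (no ¬d) = m⁺ , m<m⁺ , subst (ℕ._≤ toℕ (northeast i)) (sym m⁺≡1+m) m<ne ,
        entry-≤∧≢⇒< (ℕ.≮⇒≥ λ m⁺<m → ¬d (m⁺ , m⁺≡1+m , m⁺<m)) (Fin.<⇒≢ m<m⁺)
      step (yes d) = let j , m≡dj = descent-surjective m d in
        subst (λ m → descent π i Fin.≤ m → m Fin.< northeast i →
                     ∃[ m′ ] m Fin.< m′ × m′ Fin.≤ northeast i × entry m ℕ.< entry m′)
              (sym m≡dj) (from-descent j) d≤m m<ne

    -- Repeated use of `ascend` can stop only at `northeast i`. The result gives both `rising` and
    -- the absence of points above the hook.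
    northeast-peak : ∀ i m → descent π i Fin.≤ m → m Fin.< northeast i → entry m ℕ.< entry (northeast i)
    northeast-peak i m = go m (Fin.>-wellFounded m)
      where
      go : ∀ m → Acc Fin._>_ m → descent π i Fin.≤ m → m Fin.< northeast i → entry m ℕ.< entry (northeast i)
      go m (acc rec) d≤m m<ne = let m′ , m<m′ , m′≤ne , lower = ascend i m d≤m m<ne in
        [ (λ m′<ne → ℕ.<-trans lower (go m′ (rec m<m′) (ℕ.≤-trans d≤m (ℕ.<⇒≤ m<m′)) m′<ne))
        , (λ m′≡ne → subst (λ l → entry m ℕ.< entry l) (Fin.toℕ-injective m′≡ne) lower)
        ]′ (ℕ.m≤n⇒m<n∨m≡n m′≤ne)

    hookFrom : Fin (des π) → Hook π
    hookFrom i = record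
      { sw     = descent π i
      ; ne     = northeast i
      ; sw<ne  = descent<northeast i
      ; rising = northeast-peak i (descent π i) ℕ.≤-refl (descent<northeast i)
      }

    -- Only the horizontal segment of hook `i` and the vertical segment of hook `j` can meet: hook
    -- `j` lies wholly to the right of `descent π i`, and horizontal segments at equal heights would
    -- end at the same point, against nesting.
    hooks-meet : ∀ {i j} → i Fin.< j → ∀ p → p ∈ points π (hookFrom i) → p ∈ points π (hookFrom j) →
                 _≈ₚ_ π p (plot π (northeast i)) × _≈ₚ_ π p (plot π (descent π j))
    hooks-meet {i} {j} i<j (x , y) = meet
      where
      di<dj = descent-mono i<j

      position-≤ : ∀ {l m : Fin n} → Real.fromℕ (suc (toℕ l)) Real.≤ x →
                   x Real.≤ Real.fromℕ (suc (toℕ m)) → l Fin.≤ m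
      position-≤ {l} {m} l≤x x≤m = ℕ.s≤s⁻¹ (fromℕ-cancel-≤
        (≤-trans {Real.fromℕ (suc (toℕ l))} {x} {Real.fromℕ (suc (toℕ m))} l≤x x≤m))

      entry-≤ : ∀ {a b} → Real.fromℕ a Real.≤ y → y Real.≤ Real.fromℕ b → a ℕ.≤ b
      entry-≤ {a} {b} a≤y y≤b = fromℕ-cancel-≤ (≤-trans {Real.fromℕ a} {y} {Real.fromℕ b} a≤y y≤b)

      ≥-of : ∀ {r} a → r ≈ Real.fromℕ a → Real.fromℕ a Real.≤ r
      ≥-of {r} a r≈a = ≈⇒≤ {Real.fromℕ a} {r} (≈-sym {r} {Real.fromℕ a} r≈a)

      ≤-of : ∀ {r} a → r ≈ Real.fromℕ a → r Real.≤ Real.fromℕ a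
      ≤-of {r} a = ≈⇒≤ {r} {Real.fromℕ a}

      meet : (x , y) ∈ points π (hookFrom i) → (x , y) ∈ points π (hookFrom j) →
             _≈ₚ_ π (x , y) (plot π (northeast i)) × _≈ₚ_ π (x , y) (plot π (descent π j))
      meet (inj₁ (x≈di , _)) (inj₁ (x≈dj , _)) =
        contradiction
          (position-≤ {descent π j} {descent π i}
            (≥-of {x} (start (suc j)) x≈dj) (≤-of {x} (start (suc i)) x≈di))
          (ℕ.<⇒≱ di<dj)
      meet (inj₁ (x≈di , _)) (inj₂ (_ , dj≤x , _)) =
        contradiction (position-≤ {descent π j} {descent π i} dj≤x (≤-of {x} (start (suc i)) x≈di)) (ℕ.<⇒≱ di<dj)
      -- If `descent π j` lies before `northeast i`, then so does `northeast j`, which is therefore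
      -- too low for hook `j` to reach this height. What remains is the permitted shared endpoint.
      meet (inj₂ (y≈nei , _ , x≤nei)) (inj₁ (x≈dj , _ , y≤nej)) =
        [ (λ dj<nei → contradiction (entry-≤ (≥-of {y} (entry (northeast i)) y≈nei) y≤nej)
            (ℕ.<⇒≱ (northeast-peak i (northeast j)
              (ℕ.<⇒≤ (ℕ.<-trans di<dj (descent<northeast j))) (northeast-inner i<j dj<nei))))
        , (λ dj≡nei →
            (subst (λ m → x ≈ Real.fromℕ (suc m)) dj≡nei x≈dj , y≈nei) ,
            (x≈dj , subst (λ m → y ≈ Real.fromℕ (entry m)) (sym (Fin.toℕ-injective dj≡nei)) y≈nei))
        ]′ (ℕ.m≤n⇒m<n∨m≡n (position-≤ {descent π j} {northeast i} (≥-of {x} (start (suc j)) x≈dj) x≤nei))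
      meet (inj₂ (y≈nei , _)) (inj₂ (y≈nej , _)) =
        contradiction (northeast-inner i<j (subst (descent π j Fin.<_) (sym nei≡nej) (descent<northeast j)))
                      (ℕ.<-irrefl (cong toℕ (sym nei≡nej)))
        where
        nei≡nej : northeast i ≡ northeast j
        nei≡nej = distinct (ℕ.≤-antisym (entry-≤ (≥-of {y} (entry (northeast i)) y≈nei)
                                                 (≤-of {y} (entry (northeast j)) y≈nej))
                                        (entry-≤ (≥-of {y} (entry (northeast j)) y≈nej)
                                                 (≤-of {y} (entry (northeast i)) y≈nei)))

    configuration : VHC π
    configuration = record
      { hook    = hookFrom
      ; sw-hook = λ _ → refl
      ; noAbove = λ i m (d<m , m<ne , ne<m) → ℕ.<-asym ne<m (northeast-peak i m (ℕ.<⇒≤ d<m) m<ne)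
      ; noMeet  = disjoint
      }
      where
      disjoint : ∀ i j → i ≢ j → ∀ p → p ∈ points π (hookFrom i) → p ∈ points π (hookFrom j) →
        (_≈ₚ_ π p (plot π (northeast i)) × _≈ₚ_ π p (plot π (descent π j))) ⊎
        (_≈ₚ_ π p (plot π (descent π i)) × _≈ₚ_ π p (plot π (northeast j)))
      disjoint i j i≢j p p∈i p∈j =
        [ (λ i<j → inj₁ (hooks-meet i<j p p∈i p∈j))
        , (λ j<i → inj₂ (swap (hooks-meet j<i p p∈j p∈i)))
        ]′ (≢⇒<⊎> i≢j)

    end≡target : ∀ c → end configuration c ≡ target c
    end≡target zero    = sym target-sky
    end≡target (suc i) = suc-northeast i

    -- Both `z` and the composition of the constructed configuration bring the path back to its
    -- starting level at every target, and these equations determine the vector.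
    feasible⇒valid : z ∈ 𝒱 π
    feasible⇒valid = configuration , height-determines start start-mono start<target z (sizes configuration)
      height-target
      λ c → subst (λ e → height start (sizes configuration) e ≡ height start (sizes configuration) (start c))
              (end≡target c) (sizes-height-end configuration c)

  -- Feasibility of integer points of the hull

  height-cong : ∀ {z z′} → (∀ c → z c ≡ z′ c) → ∀ p → height start z p ≡ height start z′ p
  height-cong z≗z′ p = cong (λ t → + p - t) (sum-cong λ c → cong (λ u → 𝟙 (start c ℕ.<? p) * (1ℤ + u)) (z≗z′ c))

  valid⇒feasible : ∀ {z} → z ∈ 𝒱 π → Feasible z
  valid⇒feasible {z} (ℋ , z≗sizes) = record
    { total = trans (heights (suc n)) (trans total (sym (heights 0)))
    ; below = λ c s<p p≤n ¬exceeded → subst₂ ℤ._<_ (sym (heights _)) (sym (heights (start c)))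
        (below c s<p p≤n ¬exceeded)
    }
    where
    open Feasible (sizes-feasible ℋ)
    heights = height-cong z≗sizes

  -- Convex hulls preserve weak inequalities. The offset `e` is `1` to express a strict inequality
  -- between integers as a weak one, and `0` for each half of an equation.
  height-difference-conv : ∀ {x z} e a p → x ∈ Fer π → x ≈ᵥ (fromℤ ∘ z) →
    (∀ y → y ∈ 𝒱 π → e + height start y p ℤ.≤ height start y a) → e + height start z p ℤ.≤ height start z a
  height-difference-conv {x} {z} e a p x∈Fer x≈z valid = ℤ.0≤i-j⇒j≤i (subst (0ℤ ℤ.≤_) (sym (difference z))
    (affine-nonneg b coeff {x = x} {z} x∈Fer x≈z λ y y∈𝒱 →
      subst (0ℤ ℤ.≤_) (difference y) (ℤ.i≤j⇒0≤j-i (valid y y∈𝒱))))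
    where
    coeff : Vector ℤ (suc (des π))
    coeff c = 𝟙 (start c ℕ.<? p) - 𝟙 (start c ℕ.<? a)
    b = ((+ a - + p) + sum coeff) - e
    difference : ∀ y → height start y a - (e + height start y p) ≡ b + sum λ c → coeff c * y c
    difference y = begin
      height start y a - (e + height start y p)
        ≡⟨ solve 3 (λ A e P → A :- (e :+ P) := (A :- P) :- e) refl (height start y a) e (height start y p) ⟩
      (height start y a - height start y p) - e
        ≡⟨ cong (_- e) (height-diff start y a p) ⟩
      ((+ a - + p) + sum (λ c → coeff c * (1ℤ + y c))) - e
        ≡⟨ cong (λ t → ((+ a - + p) + t) - e) (trans
             (sum-cong λ c → solve 2 (λ k y → k :* (con 1ℤ :+ y) := k :+ k :* y) refl (coeff c) (y c))
             (sum-+ coeff (λ c → coeff c * y c))) ⟩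
      ((+ a - + p) + (sum coeff + sum (λ c → coeff c * y c))) - e
        ≡⟨ solve 4 (λ d s t e → (d :+ (s :+ t)) :- e := ((d :+ s) :- e) :+ t) refl
             (+ a - + p) (sum coeff) (sum λ c → coeff c * y c) e ⟩
      b + sum (λ c → coeff c * y c) ∎
      where
      open ≡-Reasoning
      open +-*-Solver

  conv-feasible : ∀ {x z} → x ∈ Fer π → x ≈ᵥ (fromℤ ∘ z) → Feasible z
  conv-feasible {x} {z} x∈Fer x≈z = record
    { total = ℤ.≤-antisym
        (≤-conv 0 (suc n) λ y y∈𝒱 → ℤ.≤-reflexive (total (valid⇒feasible y∈𝒱)))
        (≤-conv (suc n) 0 λ y y∈𝒱 → ℤ.≤-reflexive (sym (total (valid⇒feasible y∈𝒱))))
    ; below = λ c {p} s<p p≤n ¬exceeded → ℤ.suc[i]≤j⇒i<j (height-difference-conv {x} {z} 1ℤ (start c) p x∈Fer x≈z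
        λ y y∈𝒱 → ℤ.i<j⇒suc[i]≤j (below (valid⇒feasible y∈𝒱) c s<p p≤n ¬exceeded))
    }
    where
    open Feasible
    ≤-conv : ∀ a p → (∀ y → y ∈ 𝒱 π → height start y p ℤ.≤ height start y a) →
             height start z p ℤ.≤ height start z a
    ≤-conv a p valid = subst (ℤ._≤ height start z a) (ℤ.+-identityˡ _)
      (height-difference-conv {x} {z} 0ℤ a p x∈Fer x≈z λ y y∈𝒱 →
        subst (ℤ._≤ height start y a) (sym (ℤ.+-identityˡ _)) (valid y y∈𝒱))

⊆conv : ∀ {d} {S : Pred (Vector ℝ d) 0ℓ} {x} → x ∈ S → x ∈ conv S
⊆conv {x = x} x∈S = 1 , (λ _ → x) , (λ _ → 1ℝ) , (λ _ → x∈S) , (λ _ → fromℕ-mono-≤ {0} {1} ℕ.z≤n) ,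
  null-resp {λ _ → 0ℚ} (λ _ → refl) null-0 ,
  λ c → null-resp (λ n → solve 1 (λ q → con 0ℚ := q :- (con 1ℚ :* q :+ con 0ℚ)) refl (seq (x c) n)) null-0
  where open ℚ-Solver

theorem3p1 : (n : ℕ) (π : Permutation n) → embed (𝒱 π) ≐ Fer π ∩ ℤ^ (suc (des π))
theorem3p1 n π =
  (λ {x} x∈𝒱@(z , _ , x≈z) → ⊆conv {x = x} x∈𝒱 , z , _ , x≈z) ,
  (λ {x} (x∈Fer , z , _ , x≈z) → z , feasible⇒valid π (conv-feasible π {x} {z} x∈Fer x≈z) , x≈z)
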